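{- The first-order theory $\mathrm{ECBDA}$ is the model completion of the theory of Boole-De Morgan algebras. Moreover, $\mathrm{ECBDA}$ is complete and eliminates quantifiers.
   Context: A De Morgan algebra is a bounded distributive lattice $(A;+,\cdot,0,1)$ ($+$ join, $\cdot$ meet) with a unary operation $\bar{\ }$ satisfying $\bar{\bar x}=x$ and $\overline{x+y}=\bar x\cdot\bar y$. A Boole-De Morgan algebra is an algebra $(A;+,\cdot,',\bar{\ },0,1)$ such that $(A;+,\cdot,',0,1)$ is a Boolean algebra (with complement $'$) and $(A;+,\cdot,\bar{\ },0,1)$ is a De Morgan algebra. Convention: $0\neq1$. Put $x^*:=(\bar x)'=\overline{(x')}$ (the two agree in every Boole-De Morgan algebra); $^*$ is a lattice automorphism of order $2$ given by a term, and a symbol for it is added to the language. Model completion: a theory $T'$ is a model companion of $T$ if $T'$ is model complete (every formula is equivalent modulo $T'$ to an existential one), every model of $T$ embeds into a model of $T'$, and every model of $T'$ embeds into a model of $T$. If $T$ has the amalgamation property (for models $M_0,M_1,M_2$ of $T$ and embeddings $f_i:M_0\to M_i$, $i=1,2$, there are a model $M$ of $T$ and embeddings $g_i:M_i\to M$ with $g_1f_1=g_2f_2$), a model companion of $T$ is called its model completion. Consistency: for $\sigma\in S_n$, a triple $(I_1,I_2,I_3)$ of subsets of $\{1,\dots,n\}$ is $\sigma$-consistent if $\sigma(I_2)=I_2$, $\sigma(I_3)=I_3$, and $(I_1\cap I_2\cap I_3)\cap\sigma(I_1\cap I_2\cap I_3)=\emptyset$. Formulas: for $y=(y_1,\dots,y_n)$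 and $I_1,I_2,I_3\subseteq\{1,\dots,n\}$, $\varphi^n_{(I_1,I_2,I_3)}(y,x)$ is the conjunction of $$\bigwedge_{i\in I_1}y_i\cdot x\bar x=0\wedge\bigwedge_{i\notin I_1}y_i\cdot x\bar x\neq0,\quad \bigwedge_{i\in I_2}y_i\cdot xx^*=0\wedge\bigwedge_{i\notin I_2}y_i\cdot xx^*\neq0,\quad \bigwedge_{i\in I_3}y_i\cdot x'\bar x=0\wedge\bigwedge_{i\notin I_3}y_i\cdot x'\bar x\neq0.$$ The theory $\mathrm{ECBDA}$ consists of the axioms of Boole-De Morgan algebras and the sentences $$\forall y_1,\dots,y_n\Big(\bigwedge_iy_i\neq0\wedge\sum_{i=1}^ny_i=1\wedge\bigwedge_{i\neq j}y_i\cdot y_j=0\wedge\bigwedge_iy_i^*=y_{\sigma(i)}\rightarrow\exists x\,\varphi^n_{(I_1,I_2,I_3)}(y,x)\Big)$$ for each integer $n\ge1$, each $\sigma\in S_n$ with $\sigma^2$ the identity, and each $\sigma$-consistent triple $(I_1,I_2,I_3)$ of subsets of $\{1,\dots,n\}$. -}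

module Defs where

open import Algebra.Core using (Op₁; Op₂)
open import Algebra.Definitions using (Congruent₁; Congruent₂)
import Algebra.Morphism.Definitions as Morphism
open import Data.Bool.Base using (if_then_else_)
open import Data.Empty.Polymorphic using () renaming (⊥ to Empty-type)
open import Data.Fin.Base using (Fin; zero; suc)
open import Data.Fin.Permutation using (Permutation′; _⟨$⟩ʳ_; _⟨$⟩ˡ_)
open import Data.Fin.Properties using (_≟_)
open import Data.Fin.Subset using (Subset; Empty; _∩_)
open import Data.Fin.Subset.Properties using (_∈?_)
open import Data.Nat.Base as ℕ using (ℕ; zero; suc)
open import Data.Product.Base using (Σ-syntax; ∃-syntax; _×_)
open import Data.Sum.Base using (_⊎_)
open import Data.Unit.Polymorphic using () renaming (⊤ to Unit-type)
open import Data.Vec.Base using (Vec; []; _∷_; lookup; tabulate)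
open import Data.Vec.Functional using (foldr)
open import Function.Bundles using (_⇔_)
open import Function.Definitions using (Congruent; Injective)
open import Level using (Level) renaming (suc to lsuc)
open import Relation.Binary.Core using (Rel)
open import Relation.Binary.PropositionalEquality using (_≡_)
open import Relation.Binary.Structures using (IsEquivalence)
open import Relation.Nullary.Decidable using (Dec; does; ¬?)
open import Relation.Nullary.Negation using (¬_)

private
  variable
    m n : ℕ

------------------------------------------------------------------------
-- First-order logic in the language {+, ·, ′, ⁻, *, 0, 1}.
-- Variables are de Bruijn indices: a formula in `Formula n` has its free
-- variables among n, and a quantifier binds index zero.

infixl 8 _′ _⁻ _⋆
infixl 7 _·_
infixl 6 _+_

data Term (n : ℕ) : Set where
  var     : Fin n → Term n
  _+_ _·_ : Term n → Term n → Term n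
  _′      : Term n → Term n   -- Boolean complement
  _⁻      : Term n → Term n   -- De Morgan negation (overline)
  _⋆      : Term n → Term n
  𝟎 𝟏     : Term n

infix  5 _≐_ _≠_
infix  4 !_
infixr 3 _∧_
infixr 2 _∨_
infixr 1 _⇒_

data Formula (n : ℕ) : Set where
  _≐_         : Term n → Term n → Formula n
  ⊤ ⊥         : Formula n
  !_          : Formula n → Formula n
  _∧_ _∨_ _⇒_ : Formula n → Formula n → Formula n
  all ex      : Formula (suc n) → Formula n

Sentence : Set
Sentence = Formula 0

_≠_ : Term n → Term n → Formula n
s ≠ t = ! (s ≐ t)

all* : Formula n → Sentence
all* {zero}  φ = φ
all* {suc n} φ = all* (all φ)

⋀ : (Fin n → Formula m) → Formula m
⋀ = foldr _∧_ ⊤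

∑ : (Fin n → Term m) → Term m
∑ = foldr _+_ 𝟎

-- Restricts a conjunct to the indices satisfying a side condition.
when : ∀ {p} {P : Set p} → Dec P → Formula n → Formula n
when p? φ = if does p? then φ else ⊤

data QuantifierFree {n : ℕ} : Formula n → Set where
  _≐_ : ∀ s t → QuantifierFree (s ≐ t)
  ⊤   : QuantifierFree ⊤
  ⊥   : QuantifierFree ⊥
  !_  : ∀ {φ} → QuantifierFree φ → QuantifierFree (! φ)
  _∧_ : ∀ {φ ψ} → QuantifierFree φ → QuantifierFree ψ → QuantifierFree (φ ∧ ψ)
  _∨_ : ∀ {φ ψ} → QuantifierFree φ → QuantifierFree ψ → QuantifierFree (φ ∨ ψ)
  _⇒_ : ∀ {φ ψ} → QuantifierFree φ → QuantifierFree ψ → QuantifierFree (φ ⇒ ψ)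

data Existential {n : ℕ} : Formula n → Set where
  qf : ∀ {φ} → QuantifierFree φ → Existential φ
  ex : ∀ {φ} → Existential φ → Existential (ex φ)

------------------------------------------------------------------------
-- Structures and satisfaction.  Structures are setoid-based: `_≈_`
-- interprets the equality symbol.  Satisfaction is Tarski's; it agrees with
-- classical satisfaction in the presence of excluded middle at level ℓ.

record Structure (ℓ : Level) : Set (lsuc ℓ) where
  infix  4 _≈_
  field
    Carrier       : Set ℓ
    _≈_           : Rel Carrier ℓ
    isEquivalence : IsEquivalence _≈_
    plus times    : Op₂ Carrier
    compl neg star : Op₁ Carrier
    zer one       : Carrier
    plus-cong     : Congruent₂ _≈_ plus
    times-cong    : Congruent₂ _≈_ times
    compl-cong    : Congruent₁ _≈_ compl
    neg-cong      : Congruent₁ _≈_ neg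
    star-cong     : Congruent₁ _≈_ star

module _ {ℓ} (M : Structure ℓ) where
  open Structure M

  ⟦_⟧ : Term n → Vec Carrier n → Carrier
  ⟦ var i ⟧ ρ = lookup ρ i
  ⟦ s + t ⟧ ρ = plus (⟦ s ⟧ ρ) (⟦ t ⟧ ρ)
  ⟦ s · t ⟧ ρ = times (⟦ s ⟧ ρ) (⟦ t ⟧ ρ)
  ⟦ t ′ ⟧   ρ = compl (⟦ t ⟧ ρ)
  ⟦ t ⁻ ⟧   ρ = neg (⟦ t ⟧ ρ)
  ⟦ t ⋆ ⟧   ρ = star (⟦ t ⟧ ρ)
  ⟦ 𝟎 ⟧     ρ = zer
  ⟦ 𝟏 ⟧     ρ = one

  Sat : Formula n → Vec Carrier n → Set ℓ
  Sat (s ≐ t) ρ = ⟦ s ⟧ ρ ≈ ⟦ t ⟧ ρ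
  Sat ⊤       ρ = Unit-type
  Sat ⊥       ρ = Empty-type
  Sat (! φ)   ρ = ¬ Sat φ ρ
  Sat (φ ∧ ψ) ρ = Sat φ ρ × Sat ψ ρ
  Sat (φ ∨ ψ) ρ = Sat φ ρ ⊎ Sat ψ ρ
  Sat (φ ⇒ ψ) ρ = Sat φ ρ → Sat ψ ρ
  Sat (all φ) ρ = (a : Carrier) → Sat φ (a ∷ ρ)
  Sat (ex φ)  ρ = Σ[ a ∈ Carrier ] Sat φ (a ∷ ρ)

record Embedding {ℓ} (M N : Structure ℓ) : Set ℓ where
  private
    module M = Structure M
    module N = Structure N
  open Morphism M.Carrier N.Carrier N._≈_
  field
    to         : M.Carrier → N.Carrier
    cong       : Congruent M._≈_ N._≈_ to
    injective  : Injective M._≈_ N._≈_ to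
    plus-homo  : Homomorphic₂ to M.plus N.plus
    times-homo : Homomorphic₂ to M.times N.times
    compl-homo : Homomorphic₁ to M.compl N.compl
    neg-homo   : Homomorphic₁ to M.neg N.neg
    star-homo  : Homomorphic₁ to M.star N.star
    zer-homo   : Homomorphic₀ to M.zer N.zer
    one-homo   : Homomorphic₀ to M.one N.one

------------------------------------------------------------------------
-- Theories.  Consequence and equivalence modulo a theory are semantic,
-- over all models in a fixed but arbitrary universe level ℓ.

Theory : Set₁
Theory = Sentence → Set

module _ (ℓ : Level) where

  Model : Theory → Structure ℓ → Set ℓ
  Model T M = ∀ {φ} → T φ → Sat M φ []

  _⊨_ : Theory → Sentence → Set (lsuc ℓ)
  T ⊨ φ = ∀ M → Model T M → Sat M φ []

  Equivalent : Theory → Formula n → Formula n → Set (lsuc ℓ)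
  Equivalent T φ ψ = ∀ M → Model T M → ∀ ρ → Sat M φ ρ ⇔ Sat M ψ ρ

  EliminatesQuantifiers : Theory → Set (lsuc ℓ)
  EliminatesQuantifiers T =
    ∀ {n} (φ : Formula n) → ∃[ ψ ] QuantifierFree ψ × Equivalent T φ ψ

  ModelComplete : Theory → Set (lsuc ℓ)
  ModelComplete T =
    ∀ {n} (φ : Formula n) → ∃[ ψ ] Existential ψ × Equivalent T φ ψ

  Consistent : Theory → Set (lsuc ℓ)
  Consistent T = ∃[ M ] Model T M

  Complete : Theory → Set (lsuc ℓ)
  Complete T = Consistent T × (∀ φ → T ⊨ φ ⊎ T ⊨ (! φ))

  EmbedsInto : Theory → Theory → Set (lsuc ℓ)
  EmbedsInto T T′ = ∀ M → Model T M → ∃[ N ] Model T′ N × Embedding M N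

  record IsModelCompanion (T T′ : Theory) : Set (lsuc ℓ) where
    field
      modelComplete : ModelComplete T′
      embeds        : EmbedsInto T T′
      embeds-back   : EmbedsInto T′ T

  Amalgamation : Theory → Set (lsuc ℓ)
  Amalgamation T =
    ∀ M₀ M₁ M₂ → Model T M₀ → Model T M₁ → Model T M₂ →
    (f₁ : Embedding M₀ M₁) (f₂ : Embedding M₀ M₂) →
    ∃[ M ] Model T M × Σ[ g₁ ∈ Embedding M₁ M ] Σ[ g₂ ∈ Embedding M₂ M ]
      (∀ a → Structure._≈_ M (to g₁ (to f₁ a)) (to g₂ (to f₂ a)))
    where open Embedding using (to)

  -- T′ is the model completion of T.
  record IsModelCompletion (T T′ : Theory) : Set (lsuc ℓ) where
    field
      amalgamation     : Amalgamation T
      isModelCompanion : IsModelCompanion T T′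

------------------------------------------------------------------------
-- Boole-De Morgan algebras

private
  pattern x = var zero
  pattern y = var (suc zero)
  pattern z = var (suc (suc zero))

data BDA : Theory where
  +-comm      : BDA (all* {2} (x + y ≐ y + x))
  ·-comm      : BDA (all* {2} (x · y ≐ y · x))
  +-assoc     : BDA (all* {3} ((x + y) + z ≐ x + (y + z)))
  ·-assoc     : BDA (all* {3} ((x · y) · z ≐ x · (y · z)))
  +-absorbs-· : BDA (all* {2} (x + x · y ≐ x))
  ·-absorbs-+ : BDA (all* {2} (x · (x + y) ≐ x))
  ·-distrib-+ : BDA (all* {3} (x · (y + z) ≐ x · y + x · z))
  +-distrib-· : BDA (all* {3} (x + y · z ≐ (x + y) · (x + z)))
  +-identity  : BDA (all* {1} (x + 𝟎 ≐ x))
  ·-identity  : BDA (all* {1} (x · 𝟏 ≐ x))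
  +-compl     : BDA (all* {1} (x + x ′ ≐ 𝟏))
  ·-compl     : BDA (all* {1} (x · x ′ ≐ 𝟎))
  ⁻-involutive : BDA (all* {1} (x ⁻ ⁻ ≐ x))
  ⁻-deMorgan  : BDA (all* {2} ((x + y) ⁻ ≐ x ⁻ · y ⁻))
  𝟎≠𝟏         : BDA (𝟎 ≠ 𝟏)
  -- The defining axiom of the added symbol.
  ⋆-def       : BDA (all* {1} (x ⋆ ≐ x ⁻ ′))

------------------------------------------------------------------------
-- ECBDA

-- The direct image σ(I): i ∈ σ(I) iff σ⁻¹(i) ∈ I.
image : Permutation′ n → Subset n → Subset n
image σ I = tabulate λ i → lookup I (σ ⟨$⟩ˡ i)

record σ-Consistent (σ : Permutation′ n) (I₁ I₂ I₃ : Subset n) : Set where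
  field
    I₂-stable : image σ I₂ ≡ I₂
    I₃-stable : image σ I₃ ≡ I₃
    disjoint  : Empty ((I₁ ∩ I₂ ∩ I₃) ∩ image σ (I₁ ∩ I₂ ∩ I₃))

-- For a term t in (y, x): y_i · t is zero for i ∈ I and nonzero for i ∉ I.
-- Here x is index zero, so y_i is `var (suc i)`.
pattern-of : Subset n → Term (suc n) → Formula (suc n)
pattern-of I t =
    ⋀ (λ i → when (i ∈? I)      (var (suc i) · t ≐ 𝟎))
  ∧ ⋀ (λ i → when (¬? (i ∈? I)) (var (suc i) · t ≠ 𝟎))

φ⟨_,_,_⟩ : (I₁ I₂ I₃ : Subset n) → Formula (suc n)
φ⟨ I₁ , I₂ , I₃ ⟩ =
    pattern-of I₁ (x · x ⁻)
  ∧ pattern-of I₂ (x · x ⋆)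
  ∧ pattern-of I₃ (x ′ · x ⁻)

ecAxiom : Permutation′ n → (I₁ I₂ I₃ : Subset n) → Sentence
ecAxiom {n} σ I₁ I₂ I₃ = all* {n}
  (   ⋀ (λ i → var i ≠ 𝟎)
    ∧ ∑ var ≐ 𝟏
    ∧ ⋀ (λ i → ⋀ λ j → when (¬? (i ≟ j)) (var i · var j ≐ 𝟎))
    ∧ ⋀ (λ i → var i ⋆ ≐ var (σ ⟨$⟩ʳ i))
  ⇒ ex φ⟨ I₁ , I₂ , I₃ ⟩ )

data ECBDA : Theory where
  bda : ∀ {φ} → BDA φ → ECBDA φ
  ec  : ∀ {n} → 1 ℕ.≤ n → (σ : Permutation′ n) →
        (∀ i → σ ⟨$⟩ʳ (σ ⟨$⟩ʳ i) ≡ i) →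
        (I₁ I₂ I₃ : Subset n) → σ-Consistent σ I₁ I₂ I₃ →
        ECBDA (ecAxiom σ I₁ I₂ I₃)

{-# OPTIONS --safe #-}
module Submission where

-- In a Boole-De Morgan algebra star is a Boolean automorphism of order two, so
-- an n-tuple generates a finite subalgebra, known once one knows which of the
-- 4ⁿ minterms in the tuple and its star vanish.  In a model of ECBDA the axioms,
-- applied to the nonvanishing minterms, realize by a new element every set of
-- vanishing minterms of an (n+1)-tuple that is compatible with the given one.
-- Hence the truth of any formula is a function of the set of vanishing minterms:
-- this gives quantifier elimination and, as the empty tuple has only one
-- possible such set, completeness.
--
-- A model M of BDA embeds as the constants into the locally constant functions
-- from Cantor space to M, where star is twisted by the antipodal map α ↦ not ∘ α.
-- Finitely many functions depend on finitely many coordinates, and the remaining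
-- coordinates supply the elements that the axioms ask for.
--
-- Amalgams are built by forcing, which avoids prime ideals and so choice: a
-- condition is a pair (a , b) with a ∈ A and b ∈ B, and it is bad if a and b are
-- separated by disjoint elements of the common subalgebra.

open import Algebra.Lattice.Bundles using (BooleanAlgebra)
import Algebra.Lattice.Properties.BooleanAlgebra as BooleanAlgebraProperties
open import Axiom.ExcludedMiddle using (ExcludedMiddle)
open import Data.Bool.Base using (Bool; true; false; not; if_then_else_) renaming (_∧_ to _&&_; _∨_ to _||_)
import Data.Bool.Properties as Bool
import Data.Empty as Empty
open import Data.Fin.Base using (Fin; zero; suc)
open import Data.Fin.Permutation using (Permutation′; permutation; _⟨$⟩ʳ_; _⟨$⟩ˡ_; inverseˡ)
open import Data.Fin.Properties using (suc-injective; _≟_)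
open import Data.Fin.Subset using (Subset; _∩_)
open import Data.Fin.Subset.Properties using (_∈?_; x∈p∩q⁻; x∈p∩q⁺)
open import Data.List.Base as List
  using (List; []; _∷_; [_]; length; filter; cartesianProduct; cartesianProductWith)
open import Data.List.Membership.Propositional using (_∈_)
open import Data.List.Membership.Propositional.Properties
  using (∈-cartesianProduct⁺; ∈-cartesianProductWith⁺; ∈-filter⁺; ∈-filter⁻; ∈-lookup)
open import Data.List.Relation.Unary.All as All using (All)
open import Data.List.Relation.Unary.AllPairs as AllPairs using (AllPairs)
open import Data.List.Relation.Unary.Any using (here; there; index)
open import Data.List.Relation.Unary.Any.Properties using (lookup-index)
open import Data.List.Relation.Unary.Unique.Propositional using (Unique)
import Data.List.Relation.Unary.Unique.Propositional.Properties as Unique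
open import Data.Nat.Base as ℕ using (ℕ; zero; suc)
import Data.Nat.Properties as ℕ
open import Data.Product.Base using (Σ-syntax; ∃-syntax; _×_; _,_; proj₁; proj₂; swap)
open import Data.Product.Function.NonDependent.Propositional using (_×-⇔_)
import Data.Product.Properties as Product
open import Data.Sum.Base using (_⊎_; inj₁; inj₂)
open import Data.Sum.Function.Propositional using (_⊎-⇔_)
import Data.Unit.Base as Unit
open import Data.Vec.Base using (Vec; []; _∷_; lookup; map; tabulate)
open import Data.Vec.Functional using (foldr)
open import Data.Vec.Properties
  using (map-∘; map-id; ∷-injective; ≡-dec; tabulate-cong; lookup∘tabulate; []=⇒lookup; lookup⇒[]=)
open import Defs
open import Function.Base using (_∘_)
open import Function.Bundles using (_⇔_; mk⇔; Equivalence)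
open import Function.Properties.Equivalence using () renaming (sym to ⇔-sym; trans to ⇔-trans)
open import Level as Level using (Lift; lift; lower)
open import Relation.Binary.Definitions using (DecidableEquality)
open import Relation.Binary.PropositionalEquality as ≡ using (_≡_; _≢_; refl)
import Relation.Binary.Reasoning.Setoid as SetoidReasoning
open import Relation.Binary.Structures using (IsEquivalence)
open import Relation.Nullary.Decidable using (Dec; yes; no; does; proof; ¬?; map′; True; toWitness)
open import Relation.Nullary.Negation using (¬_; contradiction)
open import Relation.Nullary.Reflects using (Reflects; ofʸ; ofⁿ; invert; det)

-- Points of the dual space and evaluation of terms

private variable
  m n : ℕ

-- A point of the dual space of the free Boole-De Morgan algebra on n
-- generators: its i-th entry gives the values of the generator and its star.
Point : ℕ → Set
Point = Vec (Bool × Bool)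

-- The dual of star: since star has order two, passing from the generators to their stars exchanges
-- the two bits of each entry.
τ : Point n → Point n
τ = map swap

τ-involutive : (p : Point n) → τ (τ p) ≡ p
τ-involutive p = ≡.trans (≡.sym (map-∘ swap swap p)) (map-id p)

ev : Term n → Point n → Bool
ev (var i) p = proj₁ (lookup p i)
ev (s + t) p = ev s p || ev t p
ev (s · t) p = ev s p && ev t p
ev (t ′) p = not (ev t p)
ev (t ⁻) p = not (ev t (τ p))
ev (t ⋆) p = ev t (τ p)
ev 𝟎 p = false
ev 𝟏 p = true

-- A product over the 4ⁿ closed points, because a decision procedure reduces at each of these but
-- not at a variable point.
Everywhere : ∀ n → (Point n → Set) → Set
Everywhere zero A = A []
Everywhere (suc n) A =
  (Everywhere n (A ∘ ((true , true) ∷_)) × Everywhere n (A ∘ ((true , false) ∷_))) ×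
  (Everywhere n (A ∘ ((false , true) ∷_)) × Everywhere n (A ∘ ((false , false) ∷_)))

everywhere : (A : Point n → Set) → Everywhere n A → ∀ p → A p
everywhere {zero} A h [] = h
everywhere {suc n} A ((h , _) , _) ((true , true) ∷ p) = everywhere _ h p
everywhere {suc n} A ((_ , h) , _) ((true , false) ∷ p) = everywhere _ h p
everywhere {suc n} A (_ , (h , _)) ((false , true) ∷ p) = everywhere _ h p
everywhere {suc n} A (_ , (_ , h)) ((false , false) ∷ p) = everywhere _ h p

_≟²_ : DecidableEquality (Bool × Bool)
_≟²_ = Product.≡-dec Bool._≟_ Bool._≟_

private
  pattern 𝐚 = var zero
  pattern 𝐛 = var (suc zero)
  pattern 𝐜 = var (suc (suc zero))
  pattern 𝐝 = var (suc (suc (suc zero)))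

-- The laws of Boole-De Morgan algebras

module Laws {ℓ} (M : Structure ℓ) (M⊨ : Model ℓ BDA M) where
  open Structure M public
    renaming (plus to infixl 6 _⊔_; times to infixl 7 _⊓_; compl to ∁)
  open IsEquivalence isEquivalence public
    renaming (refl to ≈-refl; sym to ≈-sym; trans to ≈-trans; reflexive to ≈-reflexive)

  booleanAlgebra : BooleanAlgebra ℓ ℓ
  booleanAlgebra = record
    { Carrier = Carrier ; _≈_ = _≈_ ; _∨_ = _⊔_ ; _∧_ = _⊓_ ; ¬_ = ∁ ; ⊤ = one ; ⊥ = zer
    ; isBooleanAlgebra = record
      { isDistributiveLattice = record
        { isLattice = record
          { isEquivalence = isEquivalence
          ; ∨-comm = λ a b → M⊨ +-comm b a
          ; ∨-assoc = λ a b c → M⊨ +-assoc c b a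
          ; ∨-cong = plus-cong
          ; ∧-comm = ∧-comm
          ; ∧-assoc = λ a b c → M⊨ ·-assoc c b a
          ; ∧-cong = times-cong
          ; absorptive = (λ a b → M⊨ +-absorbs-· b a) , (λ a b → M⊨ ·-absorbs-+ b a)
          }
        ; ∨-distrib-∧ = (λ a b c → M⊨ +-distrib-· c b a)
          , λ a b c → ≈-trans (M⊨ +-comm a (b ⊓ c))
              (≈-trans (M⊨ +-distrib-· c b a) (times-cong (M⊨ +-comm b a) (M⊨ +-comm c a)))
        ; ∧-distrib-∨ = (λ a b c → M⊨ ·-distrib-+ c b a)
          , λ a b c → ≈-trans (∧-comm (b ⊔ c) a)
              (≈-trans (M⊨ ·-distrib-+ c b a) (plus-cong (∧-comm a b) (∧-comm a c)))
        }
      ; ∨-complement = (λ a → ≈-trans (M⊨ +-comm a (∁ a)) (M⊨ +-compl a)) , M⊨ +-compl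
      ; ∧-complement = (λ a → ≈-trans (∧-comm (∁ a) a) (M⊨ ·-compl a)) , M⊨ ·-compl
      ; ¬-cong = compl-cong
      }
    }
    where
    ∧-comm : ∀ a b → a ⊓ b ≈ b ⊓ a
    ∧-comm a b = M⊨ ·-comm b a

  open BooleanAlgebra booleanAlgebra public using (setoid)
  private
    module BA where
      open BooleanAlgebra booleanAlgebra public
      open BooleanAlgebraProperties booleanAlgebra public
  open SetoidReasoning setoid

  neg-involutive : ∀ a → neg (neg a) ≈ a
  neg-involutive = M⊨ ⁻-involutive

  neg-⊔ : ∀ a b → neg (a ⊔ b) ≈ neg a ⊓ neg b
  neg-⊔ a b = M⊨ ⁻-deMorgan b a

  neg-⊓ : ∀ a b → neg (a ⊓ b) ≈ neg a ⊔ neg b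
  neg-⊓ a b = begin
    neg (a ⊓ b)                         ≈⟨ neg-cong (times-cong (neg-involutive a) (neg-involutive b)) ⟨
    neg (neg (neg a) ⊓ neg (neg b))     ≈⟨ neg-cong (neg-⊔ (neg a) (neg b)) ⟨
    neg (neg (neg a ⊔ neg b))           ≈⟨ neg-involutive _ ⟩
    neg a ⊔ neg b                       ∎

  neg-zer : neg zer ≈ one
  neg-zer = begin
    neg zer                       ≈⟨ BA.∧-identityˡ _ ⟨
    one ⊓ neg zer                 ≈⟨ times-cong (neg-involutive one) ≈-refl ⟨
    neg (neg one) ⊓ neg zer       ≈⟨ neg-⊔ _ _ ⟨
    neg (neg one ⊔ zer)           ≈⟨ neg-cong (BA.∨-identityʳ _) ⟩
    neg (neg one)                 ≈⟨ neg-involutive one ⟩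
    one                           ∎

  neg-one : neg one ≈ zer
  neg-one = ≈-trans (neg-cong (≈-sym neg-zer)) (neg-involutive zer)

  -- Complements in a distributive lattice are unique, and by the De Morgan laws `neg (∁ a)` is a
  -- complement of `neg a`.
  neg-∁ : ∀ a → neg (∁ a) ≈ ∁ (neg a)
  neg-∁ a = begin
    neg (∁ a)                                   ≈⟨ BA.∧-identityʳ _ ⟨
    neg (∁ a) ⊓ one                             ≈⟨ times-cong ≈-refl (BA.∨-complementʳ (neg a)) ⟨
    neg (∁ a) ⊓ (neg a ⊔ ∁ (neg a))             ≈⟨ BA.∧-distribˡ-∨ _ _ _ ⟩
    neg (∁ a) ⊓ neg a ⊔ neg (∁ a) ⊓ ∁ (neg a)   ≈⟨ plus-cong meet ≈-refl ⟩
    zer ⊔ neg (∁ a) ⊓ ∁ (neg a)                 ≈⟨ plus-cong (BA.∧-complementʳ (neg a)) ≈-refl ⟨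
    neg a ⊓ ∁ (neg a) ⊔ neg (∁ a) ⊓ ∁ (neg a)   ≈⟨ BA.∧-distribʳ-∨ _ _ _ ⟨
    (neg a ⊔ neg (∁ a)) ⊓ ∁ (neg a)             ≈⟨ times-cong join ≈-refl ⟩
    one ⊓ ∁ (neg a)                             ≈⟨ BA.∧-identityˡ _ ⟩
    ∁ (neg a)                                   ∎
    where
    meet : neg (∁ a) ⊓ neg a ≈ zer
    meet = ≈-trans (≈-sym (neg-⊔ _ _)) (≈-trans (neg-cong (BA.∨-complementˡ a)) neg-one)
    join : neg a ⊔ neg (∁ a) ≈ one
    join = ≈-trans (≈-sym (neg-⊓ _ _)) (≈-trans (neg-cong (BA.∧-complementʳ a)) neg-zer)

  star≈ : ∀ a → star a ≈ ∁ (neg a)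
  star≈ = M⊨ ⋆-def

  neg≈ : ∀ a → neg a ≈ ∁ (star a)
  neg≈ a = ≈-trans (≈-sym (BA.¬-involutive (neg a))) (compl-cong (≈-sym (star≈ a)))

  star-⊓ : ∀ a b → star (a ⊓ b) ≈ star a ⊓ star b
  star-⊓ a b = begin
    star (a ⊓ b)             ≈⟨ star≈ _ ⟩
    ∁ (neg (a ⊓ b))          ≈⟨ compl-cong (neg-⊓ a b) ⟩
    ∁ (neg a ⊔ neg b)        ≈⟨ BA.deMorgan₂ _ _ ⟩
    ∁ (neg a) ⊓ ∁ (neg b)    ≈⟨ times-cong (star≈ a) (star≈ b) ⟨
    star a ⊓ star b          ∎

  star-∁ : ∀ a → star (∁ a) ≈ ∁ (star a)
  star-∁ a = ≈-trans (star≈ _) (compl-cong (≈-trans (neg-∁ a) (≈-sym (star≈ a))))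

  star-involutive : ∀ a → star (star a) ≈ a
  star-involutive a = begin
    star (star a)          ≈⟨ star≈ _ ⟩
    ∁ (neg (star a))       ≈⟨ compl-cong (neg-cong (star≈ a)) ⟩
    ∁ (neg (∁ (neg a)))    ≈⟨ compl-cong (neg-∁ _) ⟩
    ∁ (∁ (neg (neg a)))    ≈⟨ BA.¬-involutive _ ⟩
    neg (neg a)            ≈⟨ neg-involutive a ⟩
    a                      ∎

  star-zer : star zer ≈ zer
  star-zer = ≈-trans (star≈ _) (≈-trans (compl-cong neg-zer) BA.¬⊤≈⊥)

  star-one : star one ≈ one
  star-one = ≈-trans (star≈ _) (≈-trans (compl-cong neg-one) BA.¬⊥≈⊤)

  -- Equality modulo the principal filter of `u`. For fixed `u` it is a congruence of the Boolean
  -- operations, while star moves the base to `star u`.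
  Agree : Carrier → Carrier → Carrier → Set ℓ
  Agree u a b = u ⊓ a ≈ u ⊓ b

  agree-⊔ : ∀ {u a a′ b b′} → Agree u a a′ → Agree u b b′ → Agree u (a ⊔ b) (a′ ⊔ b′)
  agree-⊔ p q = ≈-trans (BA.∧-distribˡ-∨ _ _ _) (≈-trans (plus-cong p q) (≈-sym (BA.∧-distribˡ-∨ _ _ _)))

  agree-⊓ : ∀ {u a a′ b b′} → Agree u a a′ → Agree u b b′ → Agree u (a ⊓ b) (a′ ⊓ b′)
  agree-⊓ p q = ≈-trans (split _ _ _) (≈-trans (times-cong p q) (≈-sym (split _ _ _)))
    where
    split : ∀ u a b → u ⊓ (a ⊓ b) ≈ (u ⊓ a) ⊓ (u ⊓ b)
    split u a b = begin
      u ⊓ (a ⊓ b)         ≈⟨ times-cong (BA.∧-idem u) ≈-refl ⟨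
      u ⊓ u ⊓ (a ⊓ b)     ≈⟨ BA.∧-assoc _ _ _ ⟩
      u ⊓ (u ⊓ (a ⊓ b))   ≈⟨ times-cong ≈-refl (BA.∧-assoc _ _ _) ⟨
      u ⊓ (u ⊓ a ⊓ b)     ≈⟨ times-cong ≈-refl (times-cong (BA.∧-comm u a) ≈-refl) ⟩
      u ⊓ (a ⊓ u ⊓ b)     ≈⟨ times-cong ≈-refl (BA.∧-assoc _ _ _) ⟩
      u ⊓ (a ⊓ (u ⊓ b))   ≈⟨ BA.∧-assoc _ _ _ ⟨
      u ⊓ a ⊓ (u ⊓ b)     ∎

  agree-∁ : ∀ {u a b} → Agree u a b → Agree u (∁ a) (∁ b)
  agree-∁ p = ≈-trans (relative _ _) (≈-trans (times-cong ≈-refl (compl-cong p)) (≈-sym (relative _ _)))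
    where
    relative : ∀ u a → u ⊓ ∁ a ≈ u ⊓ ∁ (u ⊓ a)
    relative u a = begin
      u ⊓ ∁ a              ≈⟨ BA.∨-identityˡ _ ⟨
      zer ⊔ u ⊓ ∁ a        ≈⟨ plus-cong (BA.∧-complementʳ u) ≈-refl ⟨
      u ⊓ ∁ u ⊔ u ⊓ ∁ a    ≈⟨ BA.∧-distribˡ-∨ _ _ _ ⟨
      u ⊓ (∁ u ⊔ ∁ a)      ≈⟨ times-cong ≈-refl (BA.deMorgan₁ _ _) ⟨
      u ⊓ ∁ (u ⊓ a)        ∎

  agree-star : ∀ {u a b} → Agree u a b → Agree (star u) (star a) (star b)
  agree-star p = ≈-trans (≈-sym (star-⊓ _ _)) (≈-trans (star-cong p) (star-⊓ _ _))

  agree-lower : ∀ {u v a b} → Agree u a b → Agree (v ⊓ u) a b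
  agree-lower p = ≈-trans (BA.∧-assoc _ _ _) (≈-trans (times-cong ≈-refl p) (≈-sym (BA.∧-assoc _ _ _)))

  agree-base : ∀ {u v a b} → u ≈ v → Agree u a b → Agree v a b
  agree-base e p = ≈-trans (times-cong (≈-sym e) ≈-refl) (≈-trans p (times-cong e ≈-refl))

  agree-cases : ∀ {u a b} c → Agree (u ⊓ c) a b → Agree (u ⊓ ∁ c) a b → Agree u a b
  agree-cases {u} {a} {b} c p q = ≈-trans (split a) (≈-trans (plus-cong p q) (≈-sym (split b)))
    where
    split : ∀ d → u ⊓ d ≈ u ⊓ c ⊓ d ⊔ u ⊓ ∁ c ⊓ d
    split d = begin
      u ⊓ d                          ≈⟨ times-cong (BA.∧-identityʳ u) ≈-refl ⟨
      u ⊓ one ⊓ d                    ≈⟨ times-cong (times-cong ≈-refl (BA.∨-complementʳ c)) ≈-refl ⟨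
      u ⊓ (c ⊔ ∁ c) ⊓ d              ≈⟨ times-cong (BA.∧-distribˡ-∨ _ _ _) ≈-refl ⟩
      (u ⊓ c ⊔ u ⊓ ∁ c) ⊓ d          ≈⟨ BA.∧-distribʳ-∨ _ _ _ ⟩
      u ⊓ c ⊓ d ⊔ u ⊓ ∁ c ⊓ d        ∎

  -- Literals, cells and minterms

  bit : Bool → Carrier
  bit true = one
  bit false = zer

  lit : Bool → Carrier → Carrier
  lit true a = a
  lit false a = ∁ a

  lit-cong : ∀ b {a a′} → a ≈ a′ → lit b a ≈ lit b a′
  lit-cong true e = e
  lit-cong false e = compl-cong e

  agree-lit : ∀ b {u a a′} → Agree u a a′ → Agree u (lit b a) (lit b a′)
  agree-lit true e = e
  agree-lit false e = agree-∁ e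

  lit-star : ∀ b a → star (lit b a) ≈ lit b (star a)
  lit-star true a = ≈-refl
  lit-star false a = star-∁ a

  bit-|| : ∀ b c → bit b ⊔ bit c ≈ bit (b || c)
  bit-|| true c = BA.∨-zeroˡ _
  bit-|| false c = BA.∨-identityˡ _

  bit-&& : ∀ b c → bit b ⊓ bit c ≈ bit (b && c)
  bit-&& true c = BA.∧-identityˡ _
  bit-&& false c = BA.∧-zeroˡ _

  bit-not : ∀ b → ∁ (bit b) ≈ bit (not b)
  bit-not true = BA.¬⊤≈⊥
  bit-not false = BA.¬⊥≈⊤

  bit-star : ∀ b → star (bit b) ≈ bit b
  bit-star true = star-one
  bit-star false = star-zer

  cell : Bool × Bool → Carrier → Carrier → Carrier
  cell (b , c) a a′ = lit b a ⊓ lit c a′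

  agree-cells : ∀ {u a b} c d → (∀ q → Agree (u ⊓ cell q c d) a b) → Agree u a b
  agree-cells {u} {a} {b} c d h = agree-cases c (step true) (step false)
    where
    step : ∀ e → Agree (u ⊓ lit e c) a b
    step e = agree-cases d (agree-base (≈-sym (BA.∧-assoc _ _ _)) (h (e , true)))
      (agree-base (≈-sym (BA.∧-assoc _ _ _)) (h (e , false)))

  minterm : (Fin n → Carrier) → Point n → Carrier
  minterm v [] = one
  minterm v (bc ∷ p) = minterm (v ∘ suc) p ⊓ cell bc (v zero) (star (v zero))

  -- Star exchanges `a` and `star a`, hence their cells `(b , c)` and `(c , b)`.
  minterm-star : (v : Fin n → Carrier) (p : Point n) → star (minterm v p) ≈ minterm v (τ p)
  minterm-star v [] = star-one
  minterm-star v ((b , c) ∷ p) = ≈-trans (star-⊓ _ _) (times-cong (minterm-star (v ∘ suc) p) (begin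
    star (lit b a ⊓ lit c (star a))          ≈⟨ star-⊓ _ _ ⟩
    star (lit b a) ⊓ star (lit c (star a))   ≈⟨ times-cong (lit-star b a)
                                                  (≈-trans (lit-star c _) (lit-cong c (star-involutive a))) ⟩
    lit b (star a) ⊓ lit c a                 ≈⟨ BA.∧-comm _ _ ⟩
    lit c a ⊓ lit b (star a)                 ∎))
    where
    a : Carrier
    a = v zero

  minterm-var : (v : Fin n → Carrier) (p : Point n) (i : Fin n) →
                Agree (minterm v p) (v i) (bit (proj₁ (lookup p i)))
  minterm-var v ((b , c) ∷ p) zero =
    agree-lower (agree-base (BA.∧-comm _ _) (agree-lower (literal b)))
    where
    literal : ∀ b → Agree (lit b (v zero)) (v zero) (bit b)
    literal true = ≈-trans (BA.∧-idem _) (≈-sym (BA.∧-identityʳ _))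
    literal false = ≈-trans (BA.∧-complementˡ _) (≈-sym (BA.∧-zeroʳ _))
  minterm-var v (_ ∷ p) (suc i) = agree-base (BA.∧-comm _ _) (agree-lower (minterm-var (v ∘ suc) p i))

  -- Below a minterm every generator and its star are constant, hence so is every term. A starred
  -- term at `p` is read off at `τ p`, because star maps the minterm of `τ p` onto that of `p`; this
  -- is why the two statements are proved together.
  minterm-eval : (t : Term n) (ρ : Vec Carrier n) (p : Point n) →
                 Agree (minterm (lookup ρ) p) (⟦_⟧ M t ρ) (bit (ev t p))
  minterm-eval-star : (t : Term n) (ρ : Vec Carrier n) (p : Point n) →
                      Agree (minterm (lookup ρ) p) (star (⟦_⟧ M t ρ)) (bit (ev t (τ p)))

  minterm-eval (var i) ρ p = minterm-var (lookup ρ) p i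
  minterm-eval (s + t) ρ p =
    ≈-trans (agree-⊔ (minterm-eval s ρ p) (minterm-eval t ρ p)) (times-cong ≈-refl (bit-|| (ev s p) (ev t p)))
  minterm-eval (s · t) ρ p =
    ≈-trans (agree-⊓ (minterm-eval s ρ p) (minterm-eval t ρ p)) (times-cong ≈-refl (bit-&& (ev s p) (ev t p)))
  minterm-eval (t ′) ρ p = ≈-trans (agree-∁ (minterm-eval t ρ p)) (times-cong ≈-refl (bit-not (ev t p)))
  minterm-eval (t ⁻) ρ p = ≈-trans (times-cong ≈-refl (neg≈ _))
    (≈-trans (agree-∁ (minterm-eval-star t ρ p)) (times-cong ≈-refl (bit-not (ev t (τ p)))))
  minterm-eval (t ⋆) ρ p = minterm-eval-star t ρ p
  minterm-eval 𝟎 ρ p = ≈-refl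
  minterm-eval 𝟏 ρ p = ≈-refl

  minterm-eval-star t ρ p =
    ≈-trans (agree-base (≈-trans (minterm-star (lookup ρ) (τ p))
                          (≈-reflexive (≡.cong (minterm (lookup ρ)) (τ-involutive p))))
              (agree-star (minterm-eval t ρ (τ p))))
            (times-cong ≈-refl (bit-star (ev t (τ p))))

  -- The minterms join to `one`: each generator in turn splits every piece into four cells.
  agree-minterms : ∀ (v : Fin n → Carrier) {a b} → (∀ p → Agree (minterm v p) a b) → a ≈ b
  agree-minterms {zero} v h = ≈-trans (≈-sym (BA.∧-identityˡ _)) (≈-trans (h []) (BA.∧-identityˡ _))
  agree-minterms {suc n} v h = agree-minterms (v ∘ suc) λ p →
    agree-cells (v zero) (star (v zero)) λ q → h (q ∷ p)

  -- For a valid identity the implicit argument is a nested product of unit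
  -- types, which eta fills in.
  solve : ∀ n (s t : Term n) {_ : Everywhere n λ p → True (ev s p Bool.≟ ev t p)} →
          ∀ ρ → ⟦_⟧ M s ρ ≈ ⟦_⟧ M t ρ
  solve n s t {h} ρ = agree-minterms (lookup ρ) λ p →
    ≈-trans (minterm-eval s ρ p)
      (≈-trans (times-cong ≈-refl (≈-reflexive (≡.cong bit (toWitness (everywhere _ h p)))))
        (≈-sym (minterm-eval t ρ p)))

  -- The inequality between `a` and `u` is phrased as an identity so that `solve` can supply it.
  zero-below : ∀ {a u} → a ≈ a ⊓ u → u ≈ zer → a ≈ zer
  zero-below e z = ≈-trans e (≈-trans (times-cong ≈-refl z) (BA.∧-zeroʳ _))

  zero-below₂ : ∀ {a u v} → a ≈ a ⊓ (u ⊔ v) → u ≈ zer → v ≈ zer → a ≈ zer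
  zero-below₂ e z z′ = zero-below e (≈-trans (plus-cong z z′) (BA.∨-identityʳ zer))

  -- From here on an inequality is the vanishing of `a ⊓ ∁ b`, so that inequalities combine through
  -- `zero-below₂`.
  below : ∀ {a b} → a ≈ b → a ⊓ ∁ b ≈ zer
  below {b = b} e = ≈-trans (times-cong e ≈-refl) (BA.∧-complementʳ b)

  below-trans : ∀ {a b c} → a ⊓ ∁ b ≈ zer → b ⊓ ∁ c ≈ zer → a ⊓ ∁ c ≈ zer
  below-trans {a} {b} {c} = zero-below₂
    (solve 3 (𝐚 · 𝐜 ′) (𝐚 · 𝐜 ′ · (𝐚 · 𝐛 ′ + 𝐛 · 𝐜 ′)) (a ∷ b ∷ c ∷ []))

  below-⊓ : ∀ {a b c d} → a ⊓ ∁ b ≈ zer → c ⊓ ∁ d ≈ zer → (a ⊓ c) ⊓ ∁ (b ⊓ d) ≈ zer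
  below-⊓ {a} {b} {c} {d} = zero-below₂
    (solve 4 (𝐚 · 𝐜 · (𝐛 · 𝐝) ′) (𝐚 · 𝐜 · (𝐛 · 𝐝) ′ · (𝐚 · 𝐛 ′ + 𝐜 · 𝐝 ′)) (a ∷ b ∷ c ∷ d ∷ []))

  below-star : ∀ {a b} → a ⊓ ∁ b ≈ zer → star a ⊓ ∁ (star b) ≈ zer
  below-star {a} {b} z = ≈-trans (solve 2 (𝐚 ⋆ · 𝐛 ⋆ ′) ((𝐚 · 𝐛 ′) ⋆) (a ∷ b ∷ [])) (≈-trans (star-cong z) star-zer)

  below-∁ : ∀ {a} b c → a ⊓ ∁ (b ⊓ ∁ c) ≈ zer → a ⊓ c ≈ zer
  below-∁ {a} b c = zero-below (solve 3 (𝐚 · 𝐜) (𝐚 · 𝐜 · (𝐚 · (𝐛 · 𝐜 ′) ′)) (a ∷ b ∷ c ∷ []))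

  ⊓-lower : ∀ a b → (a ⊓ b) ⊓ ∁ a ≈ zer
  ⊓-lower a b = solve 2 (𝐚 · 𝐛 · 𝐚 ′) 𝟎 (a ∷ b ∷ [])

  antisym : ∀ {a b} → a ⊓ ∁ b ≈ zer → b ⊓ ∁ a ≈ zer → a ≈ b
  antisym {a} {b} z z′ = begin
    a                    ≈⟨ solve 2 𝐚 (𝐚 · 𝐛 + 𝐚 · 𝐛 ′) (a ∷ b ∷ []) ⟩
    a ⊓ b ⊔ a ⊓ ∁ b      ≈⟨ plus-cong ≈-refl (≈-trans z (≈-sym z′)) ⟩
    a ⊓ b ⊔ b ⊓ ∁ a      ≈⟨ solve 2 (𝐚 · 𝐛 + 𝐛 · 𝐚 ′) 𝐛 (a ∷ b ∷ []) ⟩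
    b                    ∎

  ⊓-zeroˡ : ∀ {a} b → a ≈ zer → a ⊓ b ≈ zer
  ⊓-zeroˡ b z = ≈-trans (times-cong z ≈-refl) (BA.∧-zeroˡ b)

  ⊓-zeroʳ : ∀ a {b} → b ≈ zer → a ⊓ b ≈ zer
  ⊓-zeroʳ a z = ≈-trans (times-cong ≈-refl z) (BA.∧-zeroʳ a)

  star-zero : ∀ {a} → star a ≈ zer → a ≈ zer
  star-zero {a} z = ≈-trans (≈-sym (star-involutive a)) (≈-trans (star-cong z) star-zer)

  nontrivial : ¬ (one ≈ zer)
  nontrivial e = M⊨ 𝟎≠𝟏 (≈-sym e)

  bit-separates : ∀ b c {u} → b ≢ c → Agree u (bit b) (bit c) → u ≈ zer
  bit-separates true true b≢c _ = contradiction refl b≢c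
  bit-separates true false _ e = ≈-trans (≈-sym (BA.∧-identityʳ _)) (≈-trans e (BA.∧-zeroʳ _))
  bit-separates false true _ e = ≈-trans (≈-sym (BA.∧-identityʳ _)) (≈-trans (≈-sym e) (BA.∧-zeroʳ _))
  bit-separates false false b≢c _ = contradiction refl b≢c

  -- Finite joins and partitions

  join : (Fin n → Carrier) → Carrier
  join = foldr _⊔_ zer

  ⟦∑⟧ : (t : Fin m → Term n) (ρ : Vec Carrier n) → ⟦_⟧ M (∑ t) ρ ≡ join (λ i → ⟦_⟧ M (t i) ρ)
  ⟦∑⟧ {zero} t ρ = refl
  ⟦∑⟧ {suc m} t ρ = ≡.cong (⟦_⟧ M (t zero) ρ ⊔_) (⟦∑⟧ (t ∘ suc) ρ)

  join-cong : {y z : Fin n → Carrier} → (∀ i → y i ≈ z i) → join y ≈ join z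
  join-cong {zero} e = ≈-refl
  join-cong {suc n} e = plus-cong (e zero) (join-cong (e ∘ suc))

  ⊓-join-zero : (a : Carrier) (y : Fin n → Carrier) → (∀ i → a ⊓ y i ≈ zer) → a ⊓ join y ≈ zer
  ⊓-join-zero {zero} a y h = BA.∧-zeroʳ a
  ⊓-join-zero {suc n} a y h = ≈-trans (BA.∧-distribˡ-∨ _ _ _)
    (≈-trans (plus-cong (h zero) (⊓-join-zero a (y ∘ suc) (h ∘ suc))) (BA.∨-identityʳ _))

  ⊓-join : (a : Carrier) (y : Fin n → Carrier) (i : Fin n) →
           (∀ j → i ≢ j → a ⊓ y j ≈ zer) → a ⊓ join y ≈ a ⊓ y i
  ⊓-join a y zero h = ≈-trans (BA.∧-distribˡ-∨ _ _ _)
    (≈-trans (plus-cong ≈-refl (⊓-join-zero a (y ∘ suc) λ j → h (suc j) λ ())) (BA.∨-identityʳ _))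
  ⊓-join a y (suc i) h = ≈-trans (BA.∧-distribˡ-∨ _ _ _)
    (≈-trans (plus-cong (h zero λ ()) (⊓-join a (y ∘ suc) i λ j i≢j → h (suc j) (i≢j ∘ suc-injective)))
      (BA.∨-identityˡ _))

  -- Gluing along disjoint elements that star permutes. Star carries `y (s i)` to `y i`, so the star
  -- of the patch is governed on `y i` by `z (s i)`.
  module Patch (y : Fin n → Carrier) (y-disjoint : ∀ i j → i ≢ j → y i ⊓ y j ≈ zer)
    (s : Fin n → Fin n) (s-involutive : ∀ i → s (s i) ≡ i) (y-star : ∀ i → star (y i) ≈ y (s i))
    (z : Fin n → Carrier) where

    patch : Carrier
    patch = join λ i → y i ⊓ z i

    patch-agrees : ∀ i → Agree (y i) patch (z i)
    patch-agrees i = ≈-trans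
      (⊓-join (y i) (λ j → y j ⊓ z j) i λ j i≢j →
        zero-below (solve 3 (𝐚 · (𝐛 · 𝐜)) (𝐚 · (𝐛 · 𝐜) · (𝐚 · 𝐛)) (y i ∷ y j ∷ z j ∷ [])) (y-disjoint i j i≢j))
      (solve 2 (𝐚 · (𝐚 · 𝐛)) (𝐚 · 𝐛) (y i ∷ z i ∷ []))

    star-patch-agrees : ∀ i → Agree (y i) (star patch) (star (z (s i)))
    star-patch-agrees i = agree-base
      (≈-trans (y-star (s i)) (≈-reflexive (≡.cong y (s-involutive i)))) (agree-star (patch-agrees (s i)))

    cell-agrees : ∀ i q → Agree (y i) (cell q patch (star patch)) (cell q (z i) (star (z (s i))))
    cell-agrees i (b , c) = agree-⊓ (agree-lit b (patch-agrees i)) (agree-lit c (star-patch-agrees i))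

  lit-disjoint : ∀ {b b′} a → b ≢ b′ → lit b a ⊓ lit b′ a ≈ zer
  lit-disjoint {true} {true} a b≢ = contradiction refl b≢
  lit-disjoint {true} {false} a b≢ = BA.∧-complementʳ a
  lit-disjoint {false} {true} a b≢ = BA.∧-complementˡ a
  lit-disjoint {false} {false} a b≢ = contradiction refl b≢

  cell-disjoint : ∀ {q r} a a′ → q ≢ r → cell q a a′ ⊓ cell r a a′ ≈ zer
  cell-disjoint {b , c} {b′ , c′} a a′ q≢r with b Bool.≟ b′
  ... | yes refl = zero-below (solve 4 (𝐚 · 𝐛 · (𝐜 · 𝐝)) ((𝐚 · 𝐛 · (𝐜 · 𝐝)) · (𝐛 · 𝐝)) (_ ∷ _ ∷ _ ∷ _ ∷ []))
                     (lit-disjoint a′ (q≢r ∘ ≡.cong (b ,_)))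
  ... | no b≢b′ = zero-below (solve 4 (𝐚 · 𝐛 · (𝐜 · 𝐝)) ((𝐚 · 𝐛 · (𝐜 · 𝐝)) · (𝐚 · 𝐜)) (_ ∷ _ ∷ _ ∷ _ ∷ []))
                    (lit-disjoint a b≢b′)

  minterm-disjoint : (v : Fin n → Carrier) {p q : Point n} → p ≢ q → minterm v p ⊓ minterm v q ≈ zer
  minterm-disjoint v {[]} {[]} p≢q = contradiction refl p≢q
  minterm-disjoint v {b ∷ p} {c ∷ q} p≢q with ≡-dec _≟²_ p q
  ... | yes refl = zero-below (solve 4 (𝐚 · 𝐛 · (𝐜 · 𝐝)) ((𝐚 · 𝐛 · (𝐜 · 𝐝)) · (𝐛 · 𝐝)) (_ ∷ _ ∷ _ ∷ _ ∷ []))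
                     (cell-disjoint _ _ (p≢q ∘ ≡.cong (_∷ p)))
  ... | no p≢q′ = zero-below (solve 4 (𝐚 · 𝐛 · (𝐜 · 𝐝)) ((𝐚 · 𝐛 · (𝐜 · 𝐝)) · (𝐚 · 𝐜)) (_ ∷ _ ∷ _ ∷ _ ∷ []))
                    (minterm-disjoint (v ∘ suc) p≢q′)

  -- Sets of vanishing minterms

  reflects-≈ : ∀ {a a′ b} → a ≈ a′ → Reflects (a ≈ zer) b → Reflects (a′ ≈ zer) b
  reflects-≈ e (ofʸ z) = ofʸ (≈-trans (≈-sym e) z)
  reflects-≈ e (ofⁿ ¬z) = ofⁿ (¬z ∘ ≈-trans e)

  reflects-star : ∀ {a b} → Reflects (a ≈ zer) b → Reflects (star a ≈ zer) b
  reflects-star (ofʸ z) = ofʸ (≈-trans (star-cong z) star-zer)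
  reflects-star (ofⁿ ¬z) = ofⁿ (¬z ∘ star-zero)

  -- The points outside `Z` form the dual space of the subalgebra generated by `ρ`. As a Boolean
  -- function `Z` makes no reference to the model, so it can be compared across models.
  ZeroSet : Vec Carrier n → (Point n → Bool) → Set ℓ
  ZeroSet ρ Z = ∀ p → Reflects (minterm (lookup ρ) p ≈ zer) (Z p)

  zeroSet-symmetric : (ρ : Vec Carrier n) {Z : Point n → Bool} → ZeroSet ρ Z → ∀ p → Z (τ p) ≡ Z p
  zeroSet-symmetric ρ h p = det (h (τ p)) (reflects-≈ (minterm-star _ p) (reflects-star (h p)))

-- Satisfaction of derived formulas

module Satisfaction {ℓ} (M : Structure ℓ) where
  open Structure M

  all*-elim : {φ : Formula n} → Sat M (all* φ) [] → ∀ ρ → Sat M φ ρ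
  all*-elim h [] = h
  all*-elim h (a ∷ ρ) = all*-elim h ρ a

  all*-intro : {φ : Formula n} → (∀ ρ → Sat M φ ρ) → Sat M (all* φ) []
  all*-intro {zero} h = h []
  all*-intro {suc n} h = all*-intro λ ρ a → h (a ∷ ρ)

  ⋀-elim : {φ : Fin m → Formula n} {ρ : Vec Carrier n} → Sat M (⋀ φ) ρ → ∀ i → Sat M (φ i) ρ
  ⋀-elim (h , _) zero = h
  ⋀-elim (_ , h) (suc i) = ⋀-elim h i

  ⋀-intro : {φ : Fin m → Formula n} {ρ : Vec Carrier n} → (∀ i → Sat M (φ i) ρ) → Sat M (⋀ φ) ρ
  ⋀-intro {zero} h = _
  ⋀-intro {suc m} h = h zero , ⋀-intro (h ∘ suc)

  when-elim : ∀ {a} {A : Set a} (A? : Dec A) {φ : Formula n} {ρ : Vec Carrier n} →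
              Sat M (when A? φ) ρ → A → Sat M φ ρ
  when-elim (yes _) h _ = h
  when-elim (no ¬a) h a = contradiction a ¬a

  when-intro : ∀ {a} {A : Set a} (A? : Dec A) {φ : Formula n} {ρ : Vec Carrier n} →
               (A → Sat M φ ρ) → Sat M (when A? φ) ρ
  when-intro (yes a) h = h a
  when-intro (no _) h = _

  pattern-elim : (I : Subset n) {t : Term (suc n)} {ρ : Vec Carrier (suc n)} → Sat M (pattern-of I t) ρ →
                 ∀ i → Reflects (⟦_⟧ M (var (suc i) · t) ρ ≈ zer) (lookup I i)
  pattern-elim I (h , h′) i with lookup I i in eq
  ... | true = ofʸ (when-elim (i ∈? I) (⋀-elim h i) (lookup⇒[]= i I eq))
  ... | false = ofⁿ (when-elim (¬? (i ∈? I)) (⋀-elim h′ i) λ i∈ →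
    contradiction (≡.trans (≡.sym eq) ([]=⇒lookup i∈)) λ ())

  pattern-intro : (I : Subset n) {t : Term (suc n)} {ρ : Vec Carrier (suc n)} →
                  (∀ i → Reflects (⟦_⟧ M (var (suc i) · t) ρ ≈ zer) (lookup I i)) → Sat M (pattern-of I t) ρ
  pattern-intro I h =
      ⋀-intro (λ i → when-intro (i ∈? I) λ i∈ → invert (≡.subst (Reflects _) ([]=⇒lookup i∈) (h i)))
    , ⋀-intro (λ i → when-intro (¬? (i ∈? I)) λ i∉ →
        invert (≡.subst (Reflects _) (Bool.¬-not (i∉ ∘ lookup⇒[]= i I)) (h i)))

-- Enumerating a finite involutive subset

points : ∀ n → List (Point n)
points zero = [ [] ]
points (suc n) = cartesianProductWith _∷_ (cartesianProduct bools bools) (points n)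
  where
  bools : List Bool
  bools = true ∷ false ∷ []

∈-bools : ∀ b → b ∈ true ∷ false ∷ []
∈-bools true = here refl
∈-bools false = there (here refl)

∈-points : (p : Point n) → p ∈ points n
∈-points [] = here refl
∈-points ((b , c) ∷ p) =
  ∈-cartesianProductWith⁺ _∷_ (∈-cartesianProduct⁺ (∈-bools b) (∈-bools c)) (∈-points p)

points-unique : ∀ n → Unique (points n)
points-unique zero = All.[] AllPairs.∷ AllPairs.[]
points-unique (suc n) = Unique.cartesianProductWith⁺ _∷_ ∷-injective
  (Unique.cartesianProduct⁺ bools-unique bools-unique) (points-unique n)
  where
  bools-unique : Unique (true ∷ false ∷ [])
  bools-unique = ((λ ()) All.∷ All.[]) AllPairs.∷ (All.[] AllPairs.∷ AllPairs.[])

lookup-injective : ∀ {A : Set} {xs : List A} → Unique xs → ∀ i j → List.lookup xs i ≡ List.lookup xs j → i ≡ j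
lookup-injective (_ AllPairs.∷ _) zero zero _ = refl
lookup-injective {xs = _ ∷ xs} (x∉ AllPairs.∷ _) zero (suc j) e =
  contradiction e (All.lookup x∉ (∈-lookup {xs = xs} j))
lookup-injective {xs = _ ∷ xs} (x∉ AllPairs.∷ _) (suc i) zero e =
  contradiction (≡.sym e) (All.lookup x∉ (∈-lookup {xs = xs} i))
lookup-injective (_ AllPairs.∷ xs!) (suc i) (suc j) e = ≡.cong suc (lookup-injective xs! i j e)

-- The axioms speak of permutations of indices, so an involution of a finite set is transported to
-- the positions in a list without repetitions.
module Positions {A : Set} (f : A → A) (f-involutive : ∀ a → f (f a) ≡ a)
  (xs : List A) (xs! : Unique xs) (closed : ∀ {a} → a ∈ xs → f a ∈ xs) where

  at : Fin (length xs) → A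
  at = List.lookup xs

  move : Fin (length xs) → Fin (length xs)
  move i = index (closed (∈-lookup {xs = xs} i))

  at-move : ∀ i → at (move i) ≡ f (at i)
  at-move i = ≡.sym (lookup-index (closed (∈-lookup {xs = xs} i)))

  move-involutive : ∀ i → move (move i) ≡ i
  move-involutive i = lookup-injective xs! (move (move i)) i
    (≡.trans (at-move (move i)) (≡.trans (≡.cong f (at-move i)) (f-involutive (at i))))

  perm : Permutation′ (length xs)
  perm = permutation move move move-involutive move-involutive

-- Dually, `restrict` says that dropping the first entry maps the points outside `Z′` to points
-- outside `Z`, `cover` that this map is onto, and `symmetric` that its domain is stable under `τ`.
record Extends {n} (Z : Point n → Bool) (Z′ : Point (suc n) → Bool) : Set where
  field
    symmetric : ∀ p → Z′ (τ p) ≡ Z′ p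
    restrict  : ∀ p → Z p ≡ true → ∀ q → Z′ (q ∷ p) ≡ true
    cover     : ∀ p → (∀ q → Z′ (q ∷ p) ≡ true) → Z p ≡ true

-- Realizing extensions in models of `ECBDA`

module Realization {ℓ} (M : Structure ℓ) (M⊨ : Model ℓ ECBDA M) where
  open Laws M (λ φ → M⊨ (bda φ))
  open Satisfaction M

  -- The nonvanishing minterms of `ρ` partition `one` into nonzero elements that star permutes along
  -- `τ`. The axiom for this partition, with index sets read off from `Z′`, supplies the element.
  realize : (ρ : Vec Carrier n) {Z : Point n → Bool} {Z′ : Point (suc n) → Bool} →
            ZeroSet ρ Z → Extends Z Z′ → Σ[ a ∈ Carrier ] ZeroSet (a ∷ ρ) Z′
  realize {n} ρ {Z} {Z′} hZ ext = a , zeros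
    where
    open Extends ext

    xs : List (Point n)
    xs = filter (λ p → Z p Bool.≟ false) (points n)

    ∈-xs : ∀ p → Z p ≡ false → p ∈ xs
    ∈-xs p = ∈-filter⁺ (λ p → Z p Bool.≟ false) (∈-points p)

    ∈-xs⁻ : ∀ {p} → p ∈ xs → Z p ≡ false
    ∈-xs⁻ p∈ = proj₂ (∈-filter⁻ (λ p → Z p Bool.≟ false) {xs = points n} p∈)

    open Positions τ τ-involutive xs (Unique.filter⁺ (λ p → Z p Bool.≟ false) (points-unique n))
      (λ {p} p∈ → ∈-xs (τ p) (≡.trans (zeroSet-symmetric ρ hZ p) (∈-xs⁻ p∈)))

    k : ℕ
    k = length xs

    y : Fin k → Carrier
    y i = minterm (lookup ρ) (at i)

    vanish : ∀ p → Z p ≡ true → minterm (lookup ρ) p ≈ zer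
    vanish p e = invert (≡.subst (Reflects _) e (hZ p))

    at-index : ∀ p → Z p ≡ false → ∃[ i ] p ≡ at i
    at-index p e = index (∈-xs p e) , lookup-index (∈-xs p e)

    y-nonzero : ∀ i → ¬ (y i ≈ zer)
    y-nonzero i = invert (≡.subst (Reflects _) (∈-xs⁻ (∈-lookup {xs = xs} i)) (hZ (at i)))

    y-disjoint : ∀ i j → i ≢ j → y i ⊓ y j ≈ zer
    y-disjoint i j i≢j = minterm-disjoint _
      (i≢j ∘ lookup-injective (Unique.filter⁺ (λ p → Z p Bool.≟ false) (points-unique n)) i j)

    y-star : ∀ i → star (y i) ≈ y (move i)
    y-star i = ≈-trans (minterm-star (lookup ρ) (at i))
      (≈-reflexive (≡.cong (minterm (lookup ρ)) (≡.sym (at-move i))))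

    join-y : join y ≈ one
    join-y = agree-minterms (lookup ρ) covered
      where
      covered : ∀ p → Agree (minterm (lookup ρ) p) (join y) one
      covered p with Z p in e
      ... | true = ≈-trans (⊓-zeroˡ _ (vanish p e)) (≈-sym (⊓-zeroˡ _ (vanish p e)))
      ... | false with i , refl ← at-index p e =
        ≈-trans (⊓-join (y i) y i (y-disjoint i)) (solve 1 (𝐚 · 𝐚) (𝐚 · 𝟏) (y i ∷ []))

    -- The axioms start at n = 1; an empty partition would make `one` equal to `zer`.
    k-positive : 1 ℕ.≤ k
    k-positive with 1 ℕ.≤? k
    ... | yes 1≤k = 1≤k
    ... | no 1≰k = contradiction (≈-trans (≈-sym join-y) (none y 1≰k)) nontrivial
      where
      none : ∀ {l} (z : Fin l → Carrier) → ¬ (1 ℕ.≤ l) → join z ≈ zer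
      none {zero} z _ = ≈-refl
      none {suc l} z h = contradiction (ℕ.s≤s ℕ.z≤n) h

    zeroAt : Bool × Bool → Subset k
    zeroAt q = tabulate λ i → Z′ (q ∷ at i)

    zeroAt-move : ∀ q i → lookup (zeroAt q) (move i) ≡ Z′ (swap q ∷ at i)
    zeroAt-move q i = ≡.trans (lookup∘tabulate _ (move i))
      (≡.trans (≡.cong (λ p → Z′ (q ∷ p)) (at-move i)) (symmetric (swap q ∷ at i)))

    -- As negation is the complement of star, the three products in the axiom are the cells
    -- `(true , false)`, `(true , true)` and `(false , false)`.
    I₁ I₂ I₃ : Subset k
    I₁ = zeroAt (true , false)
    I₂ = zeroAt (true , true)
    I₃ = zeroAt (false , false)

    consistent : σ-Consistent perm I₁ I₂ I₃
    consistent = record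
      { I₂-stable = tabulate-cong (zeroAt-move (true , true))
      ; I₃-stable = tabulate-cong (zeroAt-move (false , false))
      -- For such an index all four refinements of the minterm vanish, so by `cover` the minterm
      -- itself would vanish.
      ; disjoint = λ (i , i∈) →
          let i∈I , i∈σI = x∈p∩q⁻ _ _ i∈
              i∈I₁ , i∈I₂₃ = x∈p∩q⁻ I₁ _ i∈I
              i∈I₂ , i∈I₃ = x∈p∩q⁻ I₂ _ i∈I₂₃
              σi∈I = lookup⇒[]= (move i) _ (≡.trans (≡.sym (lookup∘tabulate _ i)) ([]=⇒lookup i∈σI))
              σi∈I₁ = proj₁ (x∈p∩q⁻ I₁ _ σi∈I)
              all-zero : ∀ q → Z′ (q ∷ at i) ≡ true
              all-zero = λ where
                (true , true) → ≡.trans (≡.sym (lookup∘tabulate _ i)) ([]=⇒lookup i∈I₂)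
                (true , false) → ≡.trans (≡.sym (lookup∘tabulate _ i)) ([]=⇒lookup i∈I₁)
                (false , true) → ≡.trans (≡.sym (zeroAt-move (true , false) i)) ([]=⇒lookup σi∈I₁)
                (false , false) → ≡.trans (≡.sym (lookup∘tabulate _ i)) ([]=⇒lookup i∈I₃)
          in y-nonzero i (vanish _ (cover _ all-zero))
      }

    ys : Vec Carrier k
    ys = tabulate y

    ys≈ : ∀ i → lookup ys i ≈ y i
    ys≈ i = ≈-reflexive (lookup∘tabulate y i)

    solution : Sat M (ex φ⟨ I₁ , I₂ , I₃ ⟩) ys
    solution = all*-elim (M⊨ (ec k-positive perm move-involutive I₁ I₂ I₃ consistent)) ys
      ( ⋀-intro (λ i e → y-nonzero i (≈-trans (≈-sym (ys≈ i)) e))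
      , ≈-trans (≈-reflexive (⟦∑⟧ var ys)) (≈-trans (join-cong ys≈) join-y)
      , ⋀-intro (λ i → ⋀-intro λ j → when-intro (¬? (i ≟ j)) λ i≢j →
          ≈-trans (times-cong (ys≈ i) (ys≈ j)) (y-disjoint i j i≢j))
      , ⋀-intro (λ i → ≈-trans (star-cong (ys≈ i)) (≈-trans (y-star i) (≈-sym (ys≈ (move i))))))

    a : Carrier
    a = proj₁ solution

    piece : ∀ q t i → Reflects (lookup ys i ⊓ t ≈ zer) (lookup (zeroAt q) i) → t ≈ cell q a (star a) →
            Reflects (minterm (lookup (a ∷ ρ)) (q ∷ at i) ≈ zer) (Z′ (q ∷ at i))
    piece q t i r e = ≡.subst (Reflects _) (lookup∘tabulate _ i) (reflects-≈ (times-cong (ys≈ i) e) r)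

    pieces : ∀ q i → Reflects (minterm (lookup (a ∷ ρ)) (q ∷ at i) ≈ zer) (Z′ (q ∷ at i))
    pieces (true , true) i = piece _ _ i (pattern-elim I₂ (proj₁ (proj₂ (proj₂ solution))) i) ≈-refl
    pieces (true , false) i = piece _ _ i (pattern-elim I₁ (proj₁ (proj₂ solution)) i)
      (solve 1 (𝐚 · 𝐚 ⁻) (𝐚 · 𝐚 ⋆ ′) (a ∷ []))
    pieces (false , false) i = piece _ _ i (pattern-elim I₃ (proj₂ (proj₂ (proj₂ solution))) i)
      (solve 1 (𝐚 ′ · 𝐚 ⁻) (𝐚 ′ · 𝐚 ⋆ ′) (a ∷ []))
    -- The axiom has no clause for this cell; it is the star of the cell `(true , false)` over
    -- `move i`.
    pieces (false , true) i = ≡.subst₂ (λ p b → Reflects (minterm (lookup (a ∷ ρ)) ((false , true) ∷ p) ≈ zer) b)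
      (≡.trans (≡.cong τ (at-move i)) (τ-involutive (at i)))
      (≡.trans (≡.cong (λ p → Z′ ((true , false) ∷ p)) (at-move i)) (symmetric ((false , true) ∷ at i)))
      (reflects-≈ (minterm-star (lookup (a ∷ ρ)) ((true , false) ∷ at (move i)))
        (reflects-star (pieces (true , false) (move i))))

    zerosAt : ∀ q p b → Z p ≡ b → Reflects (minterm (lookup (a ∷ ρ)) (q ∷ p) ≈ zer) (Z′ (q ∷ p))
    zerosAt q p true e =
      ≡.subst (Reflects _) (≡.sym (restrict p e q)) (ofʸ (⊓-zeroˡ (cell q a (star a)) (vanish p e)))
    zerosAt q p false e =
      ≡.subst (λ p → Reflects (minterm (lookup (a ∷ ρ)) (q ∷ p) ≈ zer) (Z′ (q ∷ p)))
        (≡.sym (proj₂ (at-index p e))) (pieces q (proj₁ (at-index p e)))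

    zeros : ZeroSet (a ∷ ρ) Z′
    zeros (q ∷ p) = zerosAt q p (Z p) refl

-- Quantifier elimination

-- The truth value of a formula at any tuple, in any model of ECBDA, for which Z
-- is the set of vanishing minterms.
Holds : Formula n → (Point n → Bool) → Set
Holds (s ≐ t) Z = ∀ p → Z p ≡ false → ev s p ≡ ev t p
Holds ⊤ Z = Unit.⊤
Holds ⊥ Z = Empty.⊥
Holds (! φ) Z = ¬ Holds φ Z
Holds (φ ∧ ψ) Z = Holds φ Z × Holds ψ Z
Holds (φ ∨ ψ) Z = Holds φ Z ⊎ Holds ψ Z
Holds (φ ⇒ ψ) Z = Holds φ Z → Holds ψ Z
Holds (all φ) Z = ∀ Z′ → Extends Z Z′ → Holds φ Z′
Holds (ex φ) Z = ∃[ Z′ ] Extends Z Z′ × Holds φ Z′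

module Semantics {ℓ} (em : ExcludedMiddle ℓ) (M : Structure ℓ) (M⊨ : Model ℓ ECBDA M) where
  open Laws M (λ φ → M⊨ (bda φ))
  open Realization M M⊨
  open Equivalence

  zeroSet : (ρ : Vec Carrier n) → Σ[ Z ∈ (Point n → Bool) ] ZeroSet ρ Z
  zeroSet ρ = (λ p → does (em {minterm (lookup ρ) p ≈ zer})) , λ p → proof em

  extends : (a : Carrier) (ρ : Vec Carrier n) {Z : Point n → Bool} {Z′ : Point (suc n) → Bool} →
            ZeroSet ρ Z → ZeroSet (a ∷ ρ) Z′ → Extends Z Z′
  extends a ρ hZ hZ′ = record
    { symmetric = zeroSet-symmetric (a ∷ ρ) hZ′
    ; restrict = λ p e q → det (hZ′ (q ∷ p)) (ofʸ (⊓-zeroˡ _ (invert (≡.subst (Reflects _) e (hZ p)))))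
    -- The minterm of `p` is the join of its four refinements.
    ; cover = λ p e → det (hZ p) (ofʸ (begin
        minterm (lookup ρ) p          ≈⟨ solve 1 𝐚 (𝐚 · 𝟏) (_ ∷ []) ⟩
        minterm (lookup ρ) p ⊓ one    ≈⟨ agree-cells a (star a) (λ q →
                                          ≈-trans (⊓-zeroˡ one (invert (≡.subst (Reflects _) (e q) (hZ′ (q ∷ p)))))
                                            (solve 1 𝟎 (𝐚 · 𝟎) (_ ∷ []))) ⟩
        minterm (lookup ρ) p ⊓ zer    ≈⟨ solve 1 (𝐚 · 𝟎) 𝟎 (_ ∷ []) ⟩
        zer                           ∎))
    }
    where
    open SetoidReasoning setoid

  -- An equation holds exactly when both sides have the same bit at every point whose minterm
  -- survives. The quantifiers go back and forth: `realize` turns a compatible set into an element,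
  -- and `zeroSet` with `extends` turns an element into a compatible set.
  truth : (φ : Formula n) {ρ : Vec Carrier n} {Z : Point n → Bool} → ZeroSet ρ Z → Sat M φ ρ ⇔ Holds φ Z
  truth (s ≐ t) {ρ} {Z} h = mk⇔ sound complete
    where
    sound : ⟦_⟧ M s ρ ≈ ⟦_⟧ M t ρ → Holds (s ≐ t) Z
    sound e p Zp with ev s p Bool.≟ ev t p
    ... | yes same = same
    ... | no differ = contradiction
      (bit-separates (ev s p) (ev t p) differ
        (≈-trans (≈-sym (minterm-eval s ρ p)) (≈-trans (times-cong ≈-refl e) (minterm-eval t ρ p))))
      (invert (≡.subst (Reflects _) Zp (h p)))
    complete : Holds (s ≐ t) Z → ⟦_⟧ M s ρ ≈ ⟦_⟧ M t ρ
    complete e = agree-minterms (lookup ρ) λ p → at p (Z p) refl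
      where
      at : ∀ p b → Z p ≡ b → Agree (minterm (lookup ρ) p) (⟦_⟧ M s ρ) (⟦_⟧ M t ρ)
      at p true Zp = ≈-trans (⊓-zeroˡ _ zero-at) (≈-sym (⊓-zeroˡ _ zero-at))
        where
        zero-at : minterm (lookup ρ) p ≈ zer
        zero-at = invert (≡.subst (Reflects _) Zp (h p))
      at p false Zp = ≈-trans (minterm-eval s ρ p)
        (≈-trans (times-cong ≈-refl (≈-reflexive (≡.cong bit (e p Zp)))) (≈-sym (minterm-eval t ρ p)))
  truth ⊤ h = mk⇔ _ _
  truth ⊥ h = mk⇔ (λ ()) (λ ())
  truth (! φ) h = mk⇔ (_∘ from (truth φ h)) (_∘ to (truth φ h))
  truth (φ ∧ ψ) h = truth φ h ×-⇔ truth ψ h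
  truth (φ ∨ ψ) h = truth φ h ⊎-⇔ truth ψ h
  truth (φ ⇒ ψ) h = mk⇔ (λ f → to (truth ψ h) ∘ f ∘ from (truth φ h)) (λ f → from (truth ψ h) ∘ f ∘ to (truth φ h))
  truth (all φ) {ρ} h = mk⇔
    (λ f Z′ ext → let a , h′ = realize ρ h ext in to (truth φ h′) (f a))
    (λ f a → let Z′ , h′ = zeroSet (a ∷ ρ) in from (truth φ h′) (f Z′ (extends a ρ h h′)))
  truth (ex φ) {ρ} h = mk⇔
    (λ (a , s) → let Z′ , h′ = zeroSet (a ∷ ρ) in Z′ , extends a ρ h h′ , to (truth φ h′) s)
    (λ (Z′ , ext , s) → let a , h′ = realize ρ h ext in a , from (truth φ h′) s)

-- From sets of vanishing minterms to quantifier-free formulas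

mintermₜ : (Fin n → Term m) → Point n → Term m
mintermₜ v [] = 𝟏
mintermₜ v ((b , c) ∷ p) = mintermₜ (v ∘ suc) p · (litₜ b (v zero) · litₜ c (v zero ⋆))
  where
  litₜ : Bool → Term m → Term m
  litₜ true t = t
  litₜ false t = t ′

join₄ : (q₁ q₂ q₃ q₄ : Point n → Bool) → Point (suc n) → Bool
join₄ q₁ q₂ q₃ q₄ ((true , true) ∷ p) = q₁ p
join₄ q₁ q₂ q₃ q₄ ((true , false) ∷ p) = q₂ p
join₄ q₁ q₂ q₃ q₄ ((false , true) ∷ p) = q₃ p
join₄ q₁ q₂ q₃ q₄ ((false , false) ∷ p) = q₄ p

-- A decision tree that passes to K the set of all p for which t p vanishes.
branch : (Point n → Term m) → ((Point n → Bool) → Formula m) → Formula m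
branch {zero} t K = (t [] ≐ 𝟎 ∧ K (λ _ → true)) ∨ (t [] ≠ 𝟎 ∧ K (λ _ → false))
branch {suc n} t K =
  branch (t ∘ ((true , true) ∷_)) λ q₁ → branch (t ∘ ((true , false) ∷_)) λ q₂ →
  branch (t ∘ ((false , true) ∷_)) λ q₃ → branch (t ∘ ((false , false) ∷_)) λ q₄ →
  K (join₄ q₁ q₂ q₃ q₄)

branch-quantifierFree : (t : Point n → Term m) {K : (Point n → Bool) → Formula m} →
                        (∀ Z → QuantifierFree (K Z)) → QuantifierFree (branch t K)
branch-quantifierFree {zero} t h = ((t [] ≐ 𝟎) ∧ h _) ∨ ((! (t [] ≐ 𝟎)) ∧ h _)
branch-quantifierFree {suc n} t h =
  branch-quantifierFree (t ∘ ((true , true) ∷_)) λ q₁ →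
  branch-quantifierFree (t ∘ ((true , false) ∷_)) λ q₂ →
  branch-quantifierFree (t ∘ ((false , true) ∷_)) λ q₃ →
  branch-quantifierFree (t ∘ ((false , false) ∷_)) λ q₄ →
  h (join₄ q₁ q₂ q₃ q₄)

truthValue : Bool → Formula n
truthValue b = if b then ⊤ else ⊥

truthValue-quantifierFree : ∀ b → QuantifierFree {n} (truthValue b)
truthValue-quantifierFree true = ⊤
truthValue-quantifierFree false = ⊥

truthValue-sound : ∀ {ℓ a} (M : Structure ℓ) {A : Set a} (A? : Dec A) {ρ : Vec (Structure.Carrier M) n} →
                   Sat M (truthValue (does A?)) ρ ⇔ A
truthValue-sound M (yes a) = mk⇔ (λ _ → a) _
truthValue-sound M (no ¬a) = mk⇔ (λ ()) (λ a → contradiction a ¬a)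

module _ {ℓ} (em : ExcludedMiddle ℓ) (M : Structure ℓ) where
  open Structure M

  -- The four cells are split because literals reduce only at concrete bits.
  mintermₜ-sound : (M⊨ : Model ℓ BDA M) (v : Fin n → Term m) (p : Point n) (ρ : Vec Carrier m) →
                   ⟦_⟧ M (mintermₜ v p) ρ ≡ Laws.minterm M M⊨ (λ i → ⟦_⟧ M (v i) ρ) p
  mintermₜ-sound M⊨ v [] ρ = refl
  mintermₜ-sound M⊨ v ((true , true) ∷ p) ρ = ≡.cong (λ a → times a _) (mintermₜ-sound M⊨ (v ∘ suc) p ρ)
  mintermₜ-sound M⊨ v ((true , false) ∷ p) ρ = ≡.cong (λ a → times a _) (mintermₜ-sound M⊨ (v ∘ suc) p ρ)
  mintermₜ-sound M⊨ v ((false , true) ∷ p) ρ = ≡.cong (λ a → times a _) (mintermₜ-sound M⊨ (v ∘ suc) p ρ)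
  mintermₜ-sound M⊨ v ((false , false) ∷ p) ρ = ≡.cong (λ a → times a _) (mintermₜ-sound M⊨ (v ∘ suc) p ρ)

  branch-sound : (t : Point n → Term m) (K : (Point n → Bool) → Formula m) (ρ : Vec Carrier m) →
                 ∃[ Z ] (∀ p → Reflects (⟦_⟧ M (t p) ρ ≈ zer) (Z p)) × (Sat M (branch t K) ρ ⇔ Sat M (K Z) ρ)
  branch-sound {zero} t K ρ with em {⟦_⟧ M (t []) ρ ≈ zer}
  ... | yes z = (λ _ → true) , (λ where [] → ofʸ z)
      , mk⇔ (λ where (inj₁ (_ , k)) → k
                     (inj₂ (¬z , _)) → contradiction z ¬z)
            (λ k → inj₁ (z , k))
  ... | no ¬z = (λ _ → false) , (λ where [] → ofⁿ ¬z)
      , mk⇔ (λ where (inj₁ (z , _)) → contradiction z ¬z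
                     (inj₂ (_ , k)) → k)
            (λ k → inj₂ (¬z , k))
  branch-sound {suc n} t K ρ =
    let q₁ , r₁ , e₁ = branch-sound (t ∘ ((true , true) ∷_)) _ ρ
        q₂ , r₂ , e₂ = branch-sound (t ∘ ((true , false) ∷_)) _ ρ
        q₃ , r₃ , e₃ = branch-sound (t ∘ ((false , true) ∷_)) _ ρ
        q₄ , r₄ , e₄ = branch-sound (t ∘ ((false , false) ∷_)) _ ρ
    in join₄ q₁ q₂ q₃ q₄
      , (λ where ((true , true) ∷ p) → r₁ p
                 ((true , false) ∷ p) → r₂ p
                 ((false , true) ∷ p) → r₃ p
                 ((false , false) ∷ p) → r₄ p)
      , ⇔-trans e₁ (⇔-trans e₂ (⇔-trans e₃ e₄))

-- Elimination, model completeness and the decision of sentences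

module _ {ℓ} (em : ExcludedMiddle ℓ) where

  -- Used for `Holds`, which lies in `Set` and mentions no model: the formula obtained from the
  -- decision serves all models at once.
  decide : (A : Set) → Dec A
  decide A = map′ lower lift (em {Lift ℓ A})

  eliminatesQuantifiers : EliminatesQuantifiers ℓ ECBDA
  eliminatesQuantifiers {n} φ =
      branch (mintermₜ var) test
    , branch-quantifierFree _ (λ Z → truthValue-quantifierFree (does (decide (Holds φ Z))))
    , equivalent
    where
    test : (Point n → Bool) → Formula n
    test Z = truthValue (does (decide (Holds φ Z)))

    equivalent : Equivalent ℓ ECBDA φ (branch (mintermₜ var) test)
    equivalent M M⊨ ρ =
      let Z , h , e = branch-sound em M (mintermₜ var) test ρ
          M⊨′ = λ {φ} (a : BDA φ) → M⊨ (bda a)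
          h′ = λ p → ≡.subst (λ a → Reflects (Structure._≈_ M a (Structure.zer M)) (Z p))
            (mintermₜ-sound em M M⊨′ var p ρ) (h p)
      in ⇔-trans (Semantics.truth em M M⊨ φ h′) (⇔-sym (⇔-trans e (truthValue-sound M (decide (Holds φ Z)))))

  -- The only minterm here is `one`. All models thus share this set, and with it the truth values of
  -- all sentences.
  emptyTuple : ∀ M (M⊨ : Model ℓ ECBDA M) → Laws.ZeroSet M (λ φ → M⊨ (bda φ)) [] (λ _ → false)
  emptyTuple M M⊨ [] = ofⁿ (Laws.nontrivial M (λ φ → M⊨ (bda φ)))

  modelComplete : ModelComplete ℓ ECBDA
  modelComplete φ = let ψ , ψ-qf , e = eliminatesQuantifiers φ in ψ , qf ψ-qf , e

  decides : (φ : Sentence) → (_⊨_ ℓ ECBDA φ) ⊎ (_⊨_ ℓ ECBDA (! φ))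
  decides φ with decide (Holds φ (λ _ → false))
  ... | yes h = inj₁ λ M M⊨ → from (Semantics.truth em M M⊨ φ (emptyTuple M M⊨)) h
    where open Equivalence
  ... | no ¬h = inj₂ λ M M⊨ → ¬h ∘ to (Semantics.truth em M M⊨ φ (emptyTuple M M⊨))
    where open Equivalence

-- The generic extension

splice : ℕ → (α γ : ℕ → Bool) → ℕ → Bool
splice zero α γ = γ
splice (suc k) α γ zero = α zero
splice (suc k) α γ (suc i) = splice k (α ∘ suc) γ i

splice-below : ∀ k α γ i → i ℕ.< k → splice k α γ i ≡ α i
splice-below (suc k) α γ zero _ = refl
splice-below (suc k) α γ (suc i) (ℕ.s≤s i<k) = splice-below k (α ∘ suc) γ i i<k

splice-above : ∀ k α γ j → splice k α γ (k ℕ.+ j) ≡ γ j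
splice-above zero α γ j = refl
splice-above (suc k) α γ j = splice-above k (α ∘ suc) γ j

bounded : (f : Fin n → ℕ) → ∃[ k ] (∀ i → f i ℕ.≤ k)
bounded {zero} f = 0 , λ ()
bounded {suc n} f = let k , f≤k = bounded (f ∘ suc) in f zero ℕ.⊔ k , λ where
  zero → ℕ.m≤m⊔n (f zero) k
  (suc i) → ℕ.≤-trans (f≤k i) (ℕ.m≤n⊔m (f zero) k)

module Cantor {ℓ} (M : Structure ℓ) (M⊨ : Model ℓ BDA M) where
  open Laws M M⊨

  -- The bound on the relevant coordinates is kept as data, so that a common bound for finitely many
  -- functions can be computed; `_≋_` disregards it.
  record Local : Set ℓ where
    field
      value  : (ℕ → Bool) → Carrier
      depth  : ℕ
      stable : ∀ {α β} → (∀ i → i ℕ.< depth → α i ≡ β i) → value α ≈ value β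
  open Local

  infix 4 _≋_
  record _≋_ (a b : Local) : Set ℓ where
    constructor pointwise-≈
    field
      at : ∀ α → value a α ≈ value b α
  open _≋_

  constant : Carrier → Local
  constant a = record { value = λ _ → a ; depth = 0 ; stable = λ _ → ≈-refl }

  pointwise : (f : Carrier → Carrier) → (∀ {a b} → a ≈ b → f a ≈ f b) → Local → Local
  pointwise f f-cong a = record
    { value = λ α → f (value a α) ; depth = depth a ; stable = λ e → f-cong (stable a e) }

  pointwise₂ : (f : Carrier → Carrier → Carrier) → (∀ {a b c d} → a ≈ b → c ≈ d → f a c ≈ f b d) →
               Local → Local → Local
  pointwise₂ f f-cong a b = record
    { value = λ α → f (value a α) (value b α)
    ; depth = depth a ℕ.⊔ depth b
    ; stable = λ e → f-cong (stable a λ i i< → e i (ℕ.≤-trans i< (ℕ.m≤m⊔n _ _)))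
                            (stable b λ i i< → e i (ℕ.≤-trans i< (ℕ.m≤n⊔m (depth a) _)))
    }

  antipode : Local → Local
  antipode a = record
    { value = λ α → value a (not ∘ α) ; depth = depth a ; stable = λ e → stable a λ i i< → ≡.cong not (e i i<) }

  N : Structure ℓ
  N = record
    { Carrier = Local
    ; _≈_ = _≋_
    ; isEquivalence = record
      { refl = pointwise-≈ λ α → ≈-refl
      ; sym = λ e → pointwise-≈ λ α → ≈-sym (at e α)
      ; trans = λ e f → pointwise-≈ λ α → ≈-trans (at e α) (at f α)
      }
    ; plus = pointwise₂ _⊔_ plus-cong
    ; times = pointwise₂ _⊓_ times-cong
    ; compl = pointwise ∁ compl-cong
    ; neg = antipode ∘ pointwise neg neg-cong
    ; star = antipode ∘ pointwise star star-cong
    ; zer = constant zer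
    ; one = constant one
    ; plus-cong = λ e f → pointwise-≈ λ α → plus-cong (at e α) (at f α)
    ; times-cong = λ e f → pointwise-≈ λ α → times-cong (at e α) (at f α)
    ; compl-cong = λ e → pointwise-≈ λ α → compl-cong (at e α)
    ; neg-cong = λ e → pointwise-≈ λ α → neg-cong (at e (not ∘ α))
    ; star-cong = λ e → pointwise-≈ λ α → star-cong (at e (not ∘ α))
    }

  N⊨BDA : Model ℓ BDA N
  N⊨BDA +-comm b a = pointwise-≈ λ α → M⊨ +-comm (value b α) (value a α)
  N⊨BDA ·-comm b a = pointwise-≈ λ α → M⊨ ·-comm (value b α) (value a α)
  N⊨BDA +-assoc c b a = pointwise-≈ λ α → M⊨ +-assoc (value c α) (value b α) (value a α)
  N⊨BDA ·-assoc c b a = pointwise-≈ λ α → M⊨ ·-assoc (value c α) (value b α) (value a α)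
  N⊨BDA +-absorbs-· b a = pointwise-≈ λ α → M⊨ +-absorbs-· (value b α) (value a α)
  N⊨BDA ·-absorbs-+ b a = pointwise-≈ λ α → M⊨ ·-absorbs-+ (value b α) (value a α)
  N⊨BDA ·-distrib-+ c b a = pointwise-≈ λ α → M⊨ ·-distrib-+ (value c α) (value b α) (value a α)
  N⊨BDA +-distrib-· c b a = pointwise-≈ λ α → M⊨ +-distrib-· (value c α) (value b α) (value a α)
  N⊨BDA +-identity a = pointwise-≈ λ α → M⊨ +-identity (value a α)
  N⊨BDA ·-identity a = pointwise-≈ λ α → M⊨ ·-identity (value a α)
  N⊨BDA +-compl a = pointwise-≈ λ α → M⊨ +-compl (value a α)
  N⊨BDA ·-compl a = pointwise-≈ λ α → M⊨ ·-compl (value a α)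
  -- Negating a sequence twice restores it only entry by entry, and `stable` absorbs the difference.
  N⊨BDA ⁻-involutive a = pointwise-≈ λ α →
    ≈-trans (M⊨ ⁻-involutive _) (stable a λ i _ → Bool.not-involutive (α i))
  N⊨BDA ⁻-deMorgan b a = pointwise-≈ λ α → M⊨ ⁻-deMorgan (value b (not ∘ α)) (value a (not ∘ α))
  N⊨BDA 𝟎≠𝟏 e = M⊨ 𝟎≠𝟏 (at e λ _ → true)
  N⊨BDA ⋆-def a = pointwise-≈ λ α → M⊨ ⋆-def (value a (not ∘ α))

  embedding : Embedding M N
  embedding = record
    { to = constant
    ; cong = λ e → pointwise-≈ λ α → e
    ; injective = λ e → at e λ _ → true
    ; plus-homo = λ a b → pointwise-≈ λ α → ≈-refl
    ; times-homo = λ a b → pointwise-≈ λ α → ≈-refl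
    ; compl-homo = λ a → pointwise-≈ λ α → ≈-refl
    ; neg-homo = λ a → pointwise-≈ λ α → ≈-refl
    ; star-homo = λ a → pointwise-≈ λ α → ≈-refl
    ; zer-homo = pointwise-≈ λ α → ≈-refl
    ; one-homo = pointwise-≈ λ α → ≈-refl
    }

  private module N = Laws N N⊨BDA

  match : Bool → Bool → Bool
  match true b = b
  match false b = not b

  match-refl : ∀ b → match b b ≡ true
  match-refl true = refl
  match-refl false = refl

  match-≢ : ∀ {b c} → b ≢ c → match b c ≡ false
  match-≢ {true} {true} b≢c = contradiction refl b≢c
  match-≢ {true} {false} b≢c = refl
  match-≢ {false} {true} b≢c = refl
  match-≢ {false} {false} b≢c = contradiction refl b≢c

  match² : Bool × Bool → Bool × Bool → Bool
  match² (b , c) (b′ , c′) = match b b′ && match c c′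

  match²-refl : ∀ q → match² q q ≡ true
  match²-refl (b , c) = ≡.cong₂ _&&_ (match-refl b) (match-refl c)

  match²-≢ : ∀ {q r} → q ≢ r → match² q r ≡ false
  match²-≢ {b , c} {b′ , c′} q≢r with b Bool.≟ b′
  ... | yes refl = ≡.trans (≡.cong (match b b &&_) (match-≢ (q≢r ∘ ≡.cong (b ,_)))) (Bool.∧-zeroʳ _)
  ... | no b≢b′ = ≡.cong (_&& match c c′) (match-≢ b≢b′)

  lit-bit : ∀ b c → lit b (bit c) ≈ bit (match b c)
  lit-bit true c = ≈-refl
  lit-bit false c = bit-not c

  cell-bit : ∀ q r → cell q (bit (proj₁ r)) (bit (proj₂ r)) ≈ bit (match² q r)
  cell-bit (b , c) (b′ , c′) = ≈-trans (times-cong (lit-bit b b′) (lit-bit c c′)) (bit-&& (match b b′) (match c c′))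

  cell-value : ∀ q a b α → value (N.cell q a b) α ≡ cell q (value a α) (value b α)
  cell-value (true , true) a b α = refl
  cell-value (true , false) a b α = refl
  cell-value (false , true) a b α = refl
  cell-value (false , false) a b α = refl

  -- The coordinates k, k + 1 and k + 2 are fresh for all the y i.  As they vary,
  -- the pair (x , star x) is made to take on y i exactly the permitted values;
  -- coordinate k tells a sequence from its antipode, so the pair can be
  -- chosen freely where it is true and is then determined where it is false.
  module Solution {n} (σ : Permutation′ n) (σ-involutive : ∀ i → σ ⟨$⟩ʳ (σ ⟨$⟩ʳ i) ≡ i)
    (I₁ I₂ I₃ : Subset n) (consistent : σ-Consistent σ I₁ I₂ I₃)
    (y : Fin n → Local) (y-nonzero : ∀ i → ¬ (y i N.≈ N.zer))
    (y-disjoint : ∀ i j → i ≢ j → N._⊓_ (y i) (y j) N.≈ N.zer)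
    (y-star : ∀ i → N.star (y i) N.≈ y (σ ⟨$⟩ʳ i))
    where
    open σ-Consistent consistent

    s : Fin n → Fin n
    s = σ ⟨$⟩ʳ_

    -- The cells that have to vanish on `y i`. Star carries the cell `(false , true)` over `i` to
    -- the cell `(true , false)` over `s i`, whence the index in the third clause.
    forbidden : Fin n → Bool × Bool → Bool
    forbidden i (true , true) = lookup I₂ i
    forbidden i (true , false) = lookup I₁ i
    forbidden i (false , true) = lookup I₁ (s i)
    forbidden i (false , false) = lookup I₃ i

    stable-lookup : ∀ {I} → image σ I ≡ I → ∀ i → lookup I (s i) ≡ lookup I i
    stable-lookup {I} e i = ≡.trans (≡.cong (λ J → lookup J (s i)) (≡.sym e))
      (≡.trans (lookup∘tabulate _ (s i)) (≡.cong (lookup I) (inverseˡ σ)))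

    forbidden-s : ∀ i q → forbidden (s i) (swap q) ≡ forbidden i q
    forbidden-s i (true , true) = stable-lookup I₂-stable i
    forbidden-s i (true , false) = ≡.cong (lookup I₁) (σ-involutive i)
    forbidden-s i (false , true) = refl
    forbidden-s i (false , false) = stable-lookup I₃-stable i

    -- If all four cells were forbidden, stability of `I₂` and `I₃` would put both `i` and `s i`
    -- into the triple intersection, against `disjoint`.
    permitted : ∀ i → ∃[ q ] forbidden i q ≡ false
    permitted i with lookup I₁ i in e₁ | lookup I₂ i in e₂ | lookup I₃ i in e₃ | lookup I₁ (s i) in e₄
    ... | false | _ | _ | _ = (true , false) , e₁
    ... | true | false | _ | _ = (true , true) , e₂
    ... | true | true | false | _ = (false , false) , e₃
    ... | true | true | true | false = (false , true) , e₄
    ... | true | true | true | true = contradiction (i , x∈p∩q⁺ (i∈I , i∈σI)) disjoint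
      where
      in-all : ∀ j → lookup I₁ j ≡ true → lookup I₂ j ≡ true → lookup I₃ j ≡ true →
               lookup (I₁ ∩ I₂ ∩ I₃) j ≡ true
      in-all j f₁ f₂ f₃ = []=⇒lookup
        (x∈p∩q⁺ (lookup⇒[]= j I₁ f₁ , x∈p∩q⁺ (lookup⇒[]= j I₂ f₂ , lookup⇒[]= j I₃ f₃)))
      i∈I = lookup⇒[]= i _ (in-all i e₁ e₂ e₃)
      σ⁻¹≡s : σ ⟨$⟩ˡ i ≡ s i
      σ⁻¹≡s = ≡.trans (≡.cong (σ ⟨$⟩ˡ_) (≡.sym (σ-involutive i))) (inverseˡ σ)
      i∈σI = lookup⇒[]= i (image σ (I₁ ∩ I₂ ∩ I₃)) (≡.trans (lookup∘tabulate _ i)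
        (≡.trans (≡.cong (lookup (I₁ ∩ I₂ ∩ I₃)) σ⁻¹≡s)
          (in-all (s i) e₄ (≡.trans (stable-lookup I₂-stable i) e₂) (≡.trans (stable-lookup I₃-stable i) e₃))))

    choose : Fin n → Bool × Bool → Bool × Bool
    choose i q = if forbidden i q then proj₁ (permitted i) else q

    choose-permitted : ∀ i q → forbidden i (choose i q) ≡ false
    choose-permitted i q with forbidden i q in e
    ... | true = proj₂ (permitted i)
    ... | false = e

    choose-fixes : ∀ i q → forbidden i q ≡ false → choose i q ≡ q
    choose-fixes i q e rewrite e = refl

    negate : Bool × Bool → Bool × Bool
    negate (b , c) = not b , not c

    label : Fin n → Bool → Bool × Bool → Bool × Bool
    label i true q = choose i q
    label i false q = swap (choose (s i) (negate q))

    -- Star reads a function at the antipode, and over `s i` instead of `i`. Equivariance thus makes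
    -- the second bit of the label the value of the star of the element built from the first bits.
    label-s : ∀ i b q → label (s i) (not b) (negate q) ≡ swap (label i b q)
    label-s i true (b , c) rewrite σ-involutive i | Bool.not-involutive b | Bool.not-involutive c = refl
    label-s i false q = refl

    label-permitted : ∀ i b q → forbidden i (label i b q) ≡ false
    label-permitted i true q = choose-permitted i q
    label-permitted i false q = ≡.trans
      (≡.sym (forbidden-s i (swap (choose (s i) (negate q)))))
      (choose-permitted (s i) (negate q))

    label-cong : ∀ i {b b′ c c′ d d′} → b ≡ b′ → c ≡ c′ → d ≡ d′ → label i b (c , d) ≡ label i b′ (c′ , d′)
    label-cong i refl refl refl = refl

    bound : ∃[ k ] (∀ i → depth (y i) ℕ.≤ k)
    bound = bounded (depth ∘ y)

    k : ℕ
    k = proj₁ bound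

    labelAt : Fin n → (ℕ → Bool) → Bool × Bool
    labelAt i α = label i (α (k ℕ.+ 0)) (α (k ℕ.+ 1) , α (k ℕ.+ 2))

    z : Fin n → Local
    z i = record
      { value = λ α → bit (proj₁ (labelAt i α))
      ; depth = k ℕ.+ 3
      ; stable = λ e → ≈-reflexive (≡.cong (bit ∘ proj₁) (label-cong i
          (e _ (ℕ.+-monoʳ-< k (ℕ.s≤s ℕ.z≤n)))
          (e _ (ℕ.+-monoʳ-< k (ℕ.s≤s (ℕ.s≤s ℕ.z≤n))))
          (e _ (ℕ.+-monoʳ-< k (ℕ.s≤s (ℕ.s≤s (ℕ.s≤s ℕ.z≤n)))))))
      }

    open N.Patch y y-disjoint s σ-involutive y-star z renaming (patch to x) public

    cell-at : ∀ i q α → value (N.cell q (z i) (N.star (z (s i)))) α ≈ bit (match² q (labelAt i α))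
    cell-at i q α = ≈-trans (≈-reflexive (cell-value q (z i) (N.star (z (s i))) α))
      (≈-trans (times-cong ≈-refl (lit-cong (proj₂ q)
          (≈-trans (bit-star (proj₁ (labelAt (s i) (not ∘ α)))) (≈-reflexive
            (≡.cong (bit ∘ proj₁) (label-s i (α (k ℕ.+ 0)) (α (k ℕ.+ 1) , α (k ℕ.+ 2))))))))
        (cell-bit q (labelAt i α)))

    -- The leading `true` selects the clause of `label` that returns the next two bits unchanged
    -- when they are permitted.
    fresh : Bool × Bool → ℕ → Bool
    fresh q 0 = true
    fresh q 1 = proj₁ q
    fresh q _ = proj₂ q

    labelAt-splice : ∀ i q α → forbidden i q ≡ false → labelAt i (splice k α (fresh q)) ≡ q
    labelAt-splice i q α e = ≡.trans
      (label-cong i (splice-above k α (fresh q) 0) (splice-above k α (fresh q) 1) (splice-above k α (fresh q) 2))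
      (choose-fixes i q e)

    zeros : ∀ i q → Reflects (N._⊓_ (y i) (N.cell q x (N.star x)) N.≈ N.zer) (forbidden i q)
    zeros i q = decided (forbidden i q) refl
      where
      decided : ∀ b → forbidden i q ≡ b → Reflects (N._⊓_ (y i) (N.cell q x (N.star x)) N.≈ N.zer) b
      -- Labels are always permitted, so a forbidden cell is zero at every sequence.
      decided true e = ofʸ (N.≈-trans (cell-agrees i q) (pointwise-≈ λ α →
        ⊓-zeroʳ _ (≈-trans (cell-at i q α) (≈-reflexive (≡.cong bit (match²-≢ {q} {labelAt i α} λ q≡ →
          contradiction (≡.trans (≡.sym e) (≡.trans (≡.cong (forbidden i) q≡)
            (label-permitted i (α (k ℕ.+ 0)) (α (k ℕ.+ 1) , α (k ℕ.+ 2))))) λ ()))))))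
      -- Altering `α` from coordinate `k` on keeps the value of `y i` and makes the cell `one`, so
      -- the value of `y i` itself would vanish.
      decided false e = ofⁿ λ vanishes → y-nonzero i (pointwise-≈ λ α →
        let β = splice k α (fresh q) in
        ≈-trans (stable (y i) λ j j< → ≡.sym (splice-below k α (fresh q) j (ℕ.≤-trans j< (proj₂ bound i))))
          (≈-trans (solve 1 𝐚 (𝐚 · 𝟏) (value (y i) β ∷ []))
            (≈-trans (times-cong ≈-refl (≈-sym (≈-trans (cell-at i q β)
                (≈-reflexive (≡.cong bit (≡.trans (≡.cong (match² q) (labelAt-splice i q α e)) (match²-refl q)))))))
              (≈-trans (≈-sym (at (cell-agrees i q) β)) (at vanishes β)))))

  N⊨ECBDA : Model ℓ ECBDA N
  N⊨ECBDA (bda φ) = N⊨BDA φ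
  N⊨ECBDA (ec _ σ σ-involutive I₁ I₂ I₃ consistent) =
    all*-intro {φ = _ ⇒ ex φ⟨ I₁ , I₂ , I₃ ⟩} λ ys (y≠0 , _ , y-disjoint , y-star) →
    let open Solution σ σ-involutive I₁ I₂ I₃ consistent (lookup ys) (⋀-elim y≠0)
          (λ i j → when-elim (¬? (i ≟ j)) (⋀-elim (⋀-elim y-disjoint i) j)) (⋀-elim y-star)
    in x
     , pattern-intro I₁ (λ i → N.reflects-≈
         (N.solve 2 (𝐚 · (𝐛 · 𝐛 ⋆ ′)) (𝐚 · (𝐛 · 𝐛 ⁻)) (lookup ys i ∷ x ∷ [])) (zeros i (true , false)))
     , pattern-intro I₂ (λ i → zeros i (true , true))
     , pattern-intro I₃ (λ i → N.reflects-≈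
         (N.solve 2 (𝐚 · (𝐛 ′ · 𝐛 ⋆ ′)) (𝐚 · (𝐛 ′ · 𝐛 ⁻)) (lookup ys i ∷ x ∷ [])) (zeros i (false , false)))
    where open Satisfaction N

embeds : ∀ {ℓ} → EmbedsInto ℓ BDA ECBDA
embeds M M⊨ = N , N⊨ECBDA , embedding
  where open Cantor M M⊨

-- Consistency, from the two-element algebra

two : ∀ {ℓ} → Structure ℓ
two {ℓ} = record
  { Carrier = Lift ℓ Bool
  ; _≈_ = _≡_
  ; isEquivalence = ≡.isEquivalence
  ; plus = λ a b → lift (lower a || lower b)
  ; times = λ a b → lift (lower a && lower b)
  ; compl = λ a → lift (not (lower a))
  ; neg = λ a → lift (not (lower a))
  ; star = λ a → a
  ; zer = lift false
  ; one = lift true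
  ; plus-cong = ≡.cong₂ _
  ; times-cong = ≡.cong₂ _
  ; compl-cong = ≡.cong (λ a → lift (not (lower a)))
  ; neg-cong = ≡.cong (λ a → lift (not (lower a)))
  ; star-cong = ≡.cong _
  }

two⊨ : ∀ {ℓ} → Model ℓ BDA two
two⊨ +-comm b a = ≡.cong lift (Bool.∨-comm (lower a) (lower b))
two⊨ ·-comm b a = ≡.cong lift (Bool.∧-comm (lower a) (lower b))
two⊨ +-assoc c b a = ≡.cong lift (Bool.∨-assoc (lower a) (lower b) (lower c))
two⊨ ·-assoc c b a = ≡.cong lift (Bool.∧-assoc (lower a) (lower b) (lower c))
two⊨ +-absorbs-· b a = ≡.cong lift (Bool.∨-abs-∧ (lower a) (lower b))
two⊨ ·-absorbs-+ b a = ≡.cong lift (Bool.∧-abs-∨ (lower a) (lower b))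
two⊨ ·-distrib-+ c b a = ≡.cong lift (Bool.∧-distribˡ-∨ (lower a) (lower b) (lower c))
two⊨ +-distrib-· c b a = ≡.cong lift (Bool.∨-distribˡ-∧ (lower a) (lower b) (lower c))
two⊨ +-identity a = ≡.cong lift (Bool.∨-identityʳ (lower a))
two⊨ ·-identity a = ≡.cong lift (Bool.∧-identityʳ (lower a))
two⊨ +-compl a = ≡.cong lift (Bool.∨-inverseʳ (lower a))
two⊨ ·-compl a = ≡.cong lift (Bool.∧-inverseʳ (lower a))
two⊨ ⁻-involutive a = ≡.cong lift (Bool.not-involutive (lower a))
two⊨ ⁻-deMorgan b (lift true) = refl
two⊨ ⁻-deMorgan b (lift false) = refl
two⊨ 𝟎≠𝟏 ()
two⊨ ⋆-def a = ≡.cong lift (≡.sym (Bool.not-involutive (lower a)))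

consistent : ∀ {ℓ} → Consistent ℓ ECBDA
consistent = let N , N⊨ , _ = embeds two two⊨ in N , N⊨

-- Amalgamation by forcing

module _ {ℓ} (A B : Structure ℓ) (A⊨ : Model ℓ BDA A) (B⊨ : Model ℓ BDA B) where
  private
    module A = Laws A A⊨
    module B = Laws B B⊨
  open SetoidReasoning B.setoid

  -- The remaining operations and constants are expressible by meet, complement and star.
  fromReduct : (to : A.Carrier → B.Carrier) → (∀ {a b} → a A.≈ b → to a B.≈ to b) →
    (∀ {a b} → to a B.≈ to b → a A.≈ b) → (∀ a b → to (A._⊓_ a b) B.≈ B._⊓_ (to a) (to b)) →
    (∀ a → to (A.∁ a) B.≈ B.∁ (to a)) → (∀ a → to (A.star a) B.≈ B.star (to a)) → Embedding A B
  fromReduct to to-cong injective times-homo compl-homo star-homo = record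
    { to = to
    ; cong = to-cong
    ; injective = injective
    ; plus-homo = λ a b → begin
        to (A._⊔_ a b)                             ≈⟨ to-cong (A.solve 2 (𝐚 + 𝐛) ((𝐚 ′ · 𝐛 ′) ′) (a ∷ b ∷ [])) ⟩
        to (A.∁ (A._⊓_ (A.∁ a) (A.∁ b)))           ≈⟨ compl-homo _ ⟩
        B.∁ (to (A._⊓_ (A.∁ a) (A.∁ b)))           ≈⟨ B.compl-cong (times-homo _ _) ⟩
        B.∁ (B._⊓_ (to (A.∁ a)) (to (A.∁ b)))      ≈⟨ B.compl-cong (B.times-cong (compl-homo a) (compl-homo b)) ⟩
        B.∁ (B._⊓_ (B.∁ (to a)) (B.∁ (to b)))      ≈⟨ B.solve 2 ((𝐚 ′ · 𝐛 ′) ′) (𝐚 + 𝐛) (to a ∷ to b ∷ []) ⟩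
        B._⊔_ (to a) (to b)                        ∎
    ; times-homo = times-homo
    ; compl-homo = compl-homo
    ; neg-homo = λ a → begin
        to (A.neg a)          ≈⟨ to-cong (A.neg≈ a) ⟩
        to (A.∁ (A.star a))   ≈⟨ compl-homo _ ⟩
        B.∁ (to (A.star a))   ≈⟨ B.compl-cong (star-homo a) ⟩
        B.∁ (B.star (to a))   ≈⟨ B.neg≈ (to a) ⟨
        B.neg (to a)          ∎
    ; star-homo = star-homo
    ; zer-homo = zer-homo
    ; one-homo = begin
        to A.one            ≈⟨ to-cong (A.solve 0 𝟏 (𝟎 ′) []) ⟩
        to (A.∁ A.zer)      ≈⟨ compl-homo _ ⟩
        B.∁ (to A.zer)      ≈⟨ B.compl-cong zer-homo ⟩
        B.∁ B.zer           ≈⟨ B.solve 0 (𝟎 ′) 𝟏 [] ⟩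
        B.one               ∎
    }
    where
    zer-homo : to A.zer B.≈ B.zer
    zer-homo = begin
      to A.zer                               ≈⟨ to-cong (A.solve 0 𝟎 (𝟎 · 𝟎 ′) []) ⟩
      to (A._⊓_ A.zer (A.∁ A.zer))           ≈⟨ times-homo _ _ ⟩
      B._⊓_ (to A.zer) (to (A.∁ A.zer))      ≈⟨ B.times-cong B.≈-refl (compl-homo _) ⟩
      B._⊓_ (to A.zer) (B.∁ (to A.zer))      ≈⟨ B.solve 1 (𝐚 · 𝐚 ′) 𝟎 (to A.zer ∷ []) ⟩
      B.zer                                  ∎

-- The algebra of a forcing notion

record ForcingNotion ℓ : Set (Level.suc ℓ) where
  infix 4 _≼_ _⊩ₐ_
  field
    Cond : Set ℓ
    _≼_ : Cond → Cond → Set ℓ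
    ≼-refl : ∀ {p} → p ≼ p
    ≼-trans : ∀ {p q r} → p ≼ q → q ≼ r → p ≼ r
    Bad : Cond → Set ℓ
    bad-mono : ∀ {p q} → q ≼ p → Bad p → Bad q
    conj : Cond → Cond
    conj-mono : ∀ {p q} → q ≼ p → conj q ≼ conj p
    conj-conj≼ : ∀ p → conj (conj p) ≼ p
    ≼conj-conj : ∀ p → p ≼ conj (conj p)
    bad-conj : ∀ {p} → Bad p → Bad (conj p)
    unit : Cond
    unit-good : ¬ Bad unit
    Atom : Set ℓ
    _⊩ₐ_ : Cond → Atom → Set ℓ
    atom-mono : ∀ {p q a} → q ≼ p → p ⊩ₐ a → q ⊩ₐ a
    atom-stable : ∀ {p a} → (∀ {q} → q ≼ p → (∀ {r} → r ≼ q → r ⊩ₐ a → Bad r) → Bad q) → p ⊩ₐ a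

  bad-unconj : ∀ {p} → Bad (conj p) → Bad p
  bad-unconj {p} = bad-mono (≼conj-conj p) ∘ bad-conj

module ForcingAlgebra {ℓ} (F : ForcingNotion ℓ) where
  open ForcingNotion F

  -- Formal expressions, because predicates on conditions would lie one universe too high for a
  -- carrier. Classically, each names a regular open set in the preorder of good conditions.
  data Expr : Set ℓ where
    atom : Atom → Expr
    _⊔_ _⊓_ : Expr → Expr → Expr
    ∁ ⋆_ : Expr → Expr
    bot : Expr

  infix 4 _⊩_
  -- Kripke-Joyal semantics, with Bad in the role of falsity: the bad
  -- conditions force everything, so every expression is stable constructively.
  _⊩_ : Cond → Expr → Set ℓ
  p ⊩ atom a = p ⊩ₐ a
  p ⊩ s ⊔ t = ∀ {q} → q ≼ p → (∀ {r} → r ≼ q → r ⊩ s → Bad r) → (∀ {r} → r ≼ q → r ⊩ t → Bad r) → Bad q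
  p ⊩ s ⊓ t = p ⊩ s × p ⊩ t
  p ⊩ ∁ s = ∀ {q} → q ≼ p → q ⊩ s → Bad q
  p ⊩ ⋆ s = conj p ⊩ s
  p ⊩ bot = Bad p

  mono : ∀ s {p q} → q ≼ p → p ⊩ s → q ⊩ s
  mono (atom a) q≼p h = atom-mono q≼p h
  mono (s ⊔ t) q≼p h r≼q = h (≼-trans r≼q q≼p)
  mono (s ⊓ t) q≼p (h , h′) = mono s q≼p h , mono t q≼p h′
  mono (∁ s) q≼p h r≼q = h (≼-trans r≼q q≼p)
  mono (⋆ s) q≼p h = mono s (conj-mono q≼p) h
  mono bot q≼p h = bad-mono q≼p h

  -- Atoms are stable by assumption; joins, complements and `bot` are stable by the form of their
  -- clauses. For star the double complement is moved through `conj`, which has order two up to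
  -- `_≼_`.
  stable : ∀ s {p} → p ⊩ ∁ (∁ s) → p ⊩ s
  stable (atom a) h = atom-stable λ q≼p k → h q≼p λ r≼q → k r≼q
  stable (s ⊔ t) h q≼p f g = h q≼p λ r≼q st →
    st ≼-refl (λ r′≼r → f (≼-trans r′≼r r≼q)) (λ r′≼r → g (≼-trans r′≼r r≼q))
  stable (s ⊓ t) h =
    stable s (λ q≼p k → h q≼p λ r≼q st → k r≼q (proj₁ st)) , stable t (λ q≼p k → h q≼p λ r≼q st → k r≼q (proj₂ st))
  stable (∁ s) h q≼p qs = h q≼p λ r≼q k → k ≼-refl (mono s r≼q qs)
  stable (⋆ s) {p} h = stable s λ {q} q≼p* k →
    bad-unconj (h (≼-trans (conj-mono q≼p*) (conj-conj≼ p)) λ r≼q* h′ →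
      bad-unconj (k (≼-trans (conj-mono r≼q*) (conj-conj≼ q)) h′))
  stable bot h = h ≼-refl λ _ b → b

  explode : ∀ s {p} → Bad p → p ⊩ s
  explode s b = stable s λ q≼p _ → bad-mono q≼p b

  inl : ∀ s t {p} → p ⊩ s → p ⊩ s ⊔ t
  inl s t h q≼p f g = f ≼-refl (mono s q≼p h)

  inr : ∀ s t {p} → p ⊩ t → p ⊩ s ⊔ t
  inr s t h q≼p f g = g ≼-refl (mono t q≼p h)

  -- A join is forced only in the double-negated sense; stability of `u` still permits a case
  -- distinction.
  ⊔-elim : ∀ s t u {p} → p ⊩ s ⊔ t → (∀ {q} → q ≼ p → q ⊩ s → q ⊩ u) → (∀ {q} → q ≼ p → q ⊩ t → q ⊩ u) → p ⊩ u
  ⊔-elim s t u h f g = stable u λ q≼p k →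
    h q≼p (λ r≼q rs → k r≼q (f (≼-trans r≼q q≼p) rs)) (λ r≼q rt → k r≼q (g (≼-trans r≼q q≼p) rt))

  infix 4 _≋_
  record _≋_ (s t : Expr) : Set ℓ where
    constructor _↔_
    field
      to   : ∀ {p} → p ⊩ s → p ⊩ t
      from : ∀ {p} → p ⊩ t → p ⊩ s

  P : Structure ℓ
  P = record
    { Carrier = Expr
    ; _≈_ = _≋_
    ; isEquivalence = record
      { refl = (λ h → h) ↔ (λ h → h)
      ; sym = λ (f ↔ g) → g ↔ f
      ; trans = λ (f ↔ g) (f′ ↔ g′) → (λ h → f′ (f h)) ↔ (λ h → g (g′ h))
      }
    ; plus = _⊔_
    ; times = _⊓_
    ; compl = ∁
    ; neg = λ s → ∁ (⋆ s)
    ; star = ⋆_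
    ; zer = bot
    ; one = ∁ bot
    ; plus-cong = λ (f ↔ g) (f′ ↔ g′) →
        (λ h q≼p k k′ → h q≼p (λ r≼q → k r≼q ∘ f) (λ r≼q → k′ r≼q ∘ f′)) ↔
        (λ h q≼p k k′ → h q≼p (λ r≼q → k r≼q ∘ g) (λ r≼q → k′ r≼q ∘ g′))
    ; times-cong = λ (f ↔ g) (f′ ↔ g′) → (λ (h , h′) → f h , f′ h′) ↔ (λ (h , h′) → g h , g′ h′)
    ; compl-cong = λ (f ↔ g) → (λ h q≼p → h q≼p ∘ g) ↔ (λ h q≼p → h q≼p ∘ f)
    ; neg-cong = λ (f ↔ g) → (λ h q≼p → h q≼p ∘ g) ↔ (λ h q≼p → h q≼p ∘ f)
    ; star-cong = λ (f ↔ g) → f ↔ g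
    }

  P⊨BDA : Model ℓ BDA P
  P⊨BDA +-comm y x = (λ h q≼p f g → h q≼p g f) ↔ (λ h q≼p f g → h q≼p g f)
  P⊨BDA ·-comm y x = swap ↔ swap
  P⊨BDA +-assoc z y x =
    (λ h → ⊔-elim (x ⊔ y) z (x ⊔ (y ⊔ z)) h
      (λ _ h′ → ⊔-elim x y (x ⊔ (y ⊔ z)) h′ (λ _ → inl x (y ⊔ z)) (λ _ → inr x (y ⊔ z) ∘ inl y z))
      (λ _ → inr x (y ⊔ z) ∘ inr y z)) ↔
    (λ h → ⊔-elim x (y ⊔ z) ((x ⊔ y) ⊔ z) h (λ _ → inl (x ⊔ y) z ∘ inl x y)
      (λ _ h′ → ⊔-elim y z ((x ⊔ y) ⊔ z) h′ (λ _ → inl (x ⊔ y) z ∘ inr x y) (λ _ → inr (x ⊔ y) z)))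
  P⊨BDA ·-assoc z y x = (λ ((h , h′) , h″) → h , h′ , h″) ↔ (λ (h , h′ , h″) → (h , h′) , h″)
  P⊨BDA +-absorbs-· y x = (λ h → ⊔-elim x (x ⊓ y) x h (λ _ h′ → h′) (λ _ → proj₁)) ↔ inl x (x ⊓ y)
  P⊨BDA ·-absorbs-+ y x = proj₁ ↔ (λ h → h , inl x y h)
  P⊨BDA ·-distrib-+ z y x =
    (λ (h , h′) → ⊔-elim y z ((x ⊓ y) ⊔ (x ⊓ z)) h′
      (λ q≼p k → inl (x ⊓ y) (x ⊓ z) (mono x q≼p h , k)) (λ q≼p k → inr (x ⊓ y) (x ⊓ z) (mono x q≼p h , k))) ↔
    (λ h → ⊔-elim (x ⊓ y) (x ⊓ z) (x ⊓ (y ⊔ z)) h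
      (λ _ (k , k′) → k , inl y z k′) (λ _ (k , k′) → k , inr y z k′))
  P⊨BDA +-distrib-· z y x =
    (λ h → ⊔-elim x (y ⊓ z) ((x ⊔ y) ⊓ (x ⊔ z)) h
      (λ _ k → inl x y k , inl x z k) (λ _ (k , k′) → inr x y k , inr x z k′)) ↔
    (λ (h , h′) → ⊔-elim x y (x ⊔ (y ⊓ z)) h (λ _ → inl x (y ⊓ z)) λ q≼p k →
      ⊔-elim x z (x ⊔ (y ⊓ z)) (mono (x ⊔ z) q≼p h′) (λ _ → inl x (y ⊓ z))
        (λ r≼q k′ → inr x (y ⊓ z) (mono y r≼q k , k′)))
  P⊨BDA +-identity x = (λ h → ⊔-elim x bot x h (λ _ k → k) (λ _ → explode x)) ↔ inl x bot
  P⊨BDA ·-identity x = proj₁ ↔ (λ h → h , λ _ b → b)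
  P⊨BDA +-compl x = (λ _ _ b → b) ↔ (λ _ _ f g → g ≼-refl f)
  P⊨BDA ·-compl x = (λ (h , k) → k ≼-refl h) ↔ (λ b → explode x b , explode (∁ x) b)
  -- The two uses of `conj` cancel, which leaves a double complement.
  P⊨BDA ⁻-involutive x =
    (λ h → stable x λ {q} q≼p k → h q≼p λ r≼q* h′ → bad-unconj (k (≼-trans (conj-mono r≼q*) (conj-conj≼ q)) h′)) ↔
    (λ h {q} q≼p k → bad-unconj (k ≼-refl (mono x (≼-trans (conj-conj≼ q) q≼p) h)))
  P⊨BDA ⁻-deMorgan y x =
    (λ h → (λ q≼p → h q≼p ∘ inl x y) , (λ q≼p → h q≼p ∘ inr x y)) ↔
    (λ (f , g) {q} q≼p h → bad-unconj (⊔-elim x y bot h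
      (λ {r} r≼q* k → bad-unconj (f (≼-trans (conj-mono r≼q*) (≼-trans (conj-conj≼ q) q≼p)) (mono x (conj-conj≼ r) k)))
      (λ {r} r≼q* k → bad-unconj (g (≼-trans (conj-mono r≼q*) (≼-trans (conj-conj≼ q) q≼p)) (mono y (conj-conj≼ r) k)))))
  P⊨BDA 𝟎≠𝟏 (f ↔ g) = unit-good (g λ _ b → b)
  P⊨BDA ⋆-def x = (λ h q≼p k → k ≼-refl (mono (⋆ x) q≼p h)) ↔ stable (⋆ x)

  -- Embedding an algebra into a forcing algebra

  module Generators (S : Structure ℓ) (S⊨ : Model ℓ BDA S) where
    private module S = Laws S S⊨

    -- `p ↾ c` stands for `p` strengthened by `c`. The interface is abstract because the two factors
    -- of an amalgam restrict different coordinates of a condition.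
    module Restriction
      (_↾_ : Cond → S.Carrier → Cond)
      (gen : S.Carrier → Atom)
      (gen-forced : ∀ {p c} → Bad (p ↾ S.∁ c) → p ⊩ₐ gen c)
      (gen-forces : ∀ {p c} → p ⊩ₐ gen c → Bad (p ↾ S.∁ c))
      (↾-lower : ∀ p c → p ↾ c ≼ p)
      (↾-mono : ∀ {p q c d} → q ≼ p → S._⊓_ c (S.∁ d) S.≈ S.zer → Bad (p ↾ d) → Bad (q ↾ c))
      (↾-split : ∀ {p} c → Bad (p ↾ c) → Bad (p ↾ S.∁ c) → Bad p)
      (↾-merge : ∀ {p c d} → Bad ((p ↾ c) ↾ d) → Bad (p ↾ S._⊓_ c d))
      (↾-iterate : ∀ {p c d} → Bad (p ↾ S._⊓_ c d) → Bad ((p ↾ c) ↾ d))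
      (↾-conj : ∀ {p c} → Bad (p ↾ c) → Bad (conj p ↾ S.star c))
      (↾-zero : ∀ {p c} → c S.≈ S.zer → Bad (p ↾ c))
      (↾-unit : ∀ {c} → Bad (unit ↾ c) → c S.≈ S.zer)
      where

      ι : S.Carrier → Expr
      ι c = atom (gen c)

      ι-mono : ∀ {c d p} → S._⊓_ c (S.∁ d) S.≈ S.zer → p ⊩ ι c → p ⊩ ι d
      ι-mono {c} {d} e h = gen-forced (↾-mono ≼-refl
        (S.≈-trans (S.solve 2 (𝐛 ′ · 𝐚 ′ ′) (𝐚 · 𝐛 ′) (c ∷ d ∷ [])) e) (gen-forces h))

      ι-cong : ∀ {c d} → c S.≈ d → ι c ≋ ι d
      ι-cong e = ι-mono (S.below e) ↔ ι-mono (S.below (S.≈-sym e))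

      -- The test condition is `unit ↾ c`: it forces `ι c`, and if it forces `ι d` then `unit`
      -- restricted to the difference of `c` and `d` is bad.
      ι-reflects : ∀ {c d} → (∀ {p} → p ⊩ ι c → p ⊩ ι d) → S._⊓_ c (S.∁ d) S.≈ S.zer
      ι-reflects {c} f = ↾-unit (↾-merge (gen-forces (f (gen-forced
        (↾-iterate (↾-zero (S.solve 1 (𝐚 · 𝐚 ′) 𝟎 (c ∷ []))))))))

      embedding : Embedding S P
      embedding = fromReduct S P S⊨ P⊨BDA ι ι-cong
        (λ (f ↔ g) → S.antisym (ι-reflects f) (ι-reflects g))
        (λ c d →
          (λ h → ι-mono (S.solve 2 (𝐚 · 𝐛 · 𝐚 ′) 𝟎 (c ∷ d ∷ [])) h
               , ι-mono (S.solve 2 (𝐚 · 𝐛 · 𝐛 ′) 𝟎 (c ∷ d ∷ [])) h) ↔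
          -- Inside `c` the complement of the meet lies below the complement of `d`, and outside `c`
          -- below that of `c`.
          (λ (h , k) → gen-forced (↾-split c
            (↾-iterate (↾-mono ≼-refl (S.solve 2 ((𝐚 · 𝐛) ′ · 𝐚 · 𝐛 ′ ′) 𝟎 (c ∷ d ∷ [])) (gen-forces k)))
            (↾-iterate (↾-mono ≼-refl (S.solve 2 ((𝐚 · 𝐛) ′ · 𝐚 ′ · 𝐚 ′ ′) 𝟎 (c ∷ d ∷ [])) (gen-forces h))))))
        (λ c →
          (λ h q≼p k → ↾-split c
            (↾-mono q≼p (S.solve 1 (𝐚 · 𝐚 ′ ′ ′) 𝟎 (c ∷ [])) (gen-forces h)) (gen-forces k)) ↔
          (λ k → gen-forced (k (↾-lower _ _) (gen-forced
            (↾-iterate (↾-zero (S.solve 1 (𝐚 ′ ′ · 𝐚 ′) 𝟎 (c ∷ []))))))))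
        (λ c →
          (λ h → gen-forced (↾-mono ≼-refl (S.solve 1 (𝐚 ′ · 𝐚 ⋆ ′ ⋆ ′) 𝟎 (c ∷ [])) (↾-conj (gen-forces h)))) ↔
          (λ h → gen-forced (↾-mono (≼conj-conj _) (S.solve 1 (𝐚 ⋆ ′ · 𝐚 ′ ⋆ ′) 𝟎 (c ∷ [])) (↾-conj (gen-forces h)))))

-- Separation by the common subalgebra

module Separation {ℓ} (C A B : Structure ℓ)
  (C⊨ : Model ℓ BDA C) (A⊨ : Model ℓ BDA A) (B⊨ : Model ℓ BDA B) (f : Embedding C A) (g : Embedding C B) where
  private
    module C = Laws C C⊨
    module A = Laws A A⊨
    module B = Laws B B⊨
    module f = Embedding f
    module g = Embedding g

  -- The criterion for a and b to be disjoint in the free amalgam.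
  record Separated (a : A.Carrier) (b : B.Carrier) : Set ℓ where
    field
      left right : C.Carrier
      disjoint   : C._⊓_ left right C.≈ C.zer
      below-left : A._⊓_ a (A.∁ (f.to left)) A.≈ A.zer
      below-right : B._⊓_ b (B.∁ (g.to right)) B.≈ B.zer
  open Separated

  separated-mono : ∀ {a a′ b b′} → A._⊓_ a′ (A.∁ a) A.≈ A.zer → B._⊓_ b′ (B.∁ b) B.≈ B.zer →
                   Separated a b → Separated a′ b′
  separated-mono e e′ h = record
    { left = left h
    ; right = right h
    ; disjoint = disjoint h
    ; below-left = A.below-trans e (below-left h)
    ; below-right = B.below-trans e′ (below-right h)
    }

  -- The left separators are joined and the right ones met.
  separated-split : ∀ {a b} c → Separated (A._⊓_ a c) b → Separated (A._⊓_ a (A.∁ c)) b → Separated a b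
  separated-split {a} {b} c h k = record
    { left = C._⊔_ (left h) (left k)
    ; right = C._⊓_ (right h) (right k)
    ; disjoint = C.zero-below₂
        (C.solve 4 ((𝐚 + 𝐜) · (𝐛 · 𝐝)) ((𝐚 + 𝐜) · (𝐛 · 𝐝) · (𝐚 · 𝐛 + 𝐜 · 𝐝))
          (left h ∷ right h ∷ left k ∷ right k ∷ [])) (disjoint h) (disjoint k)
    ; below-left = A.≈-trans (A.times-cong A.≈-refl (A.compl-cong (f.plus-homo _ _))) (A.zero-below₂
        (A.solve 4 (𝐚 · (𝐜 + 𝐝) ′) (𝐚 · (𝐜 + 𝐝) ′ · (𝐚 · 𝐛 · 𝐜 ′ + 𝐚 · 𝐛 ′ · 𝐝 ′))
          (a ∷ c ∷ f.to (left h) ∷ f.to (left k) ∷ [])) (below-left h) (below-left k))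
    ; below-right = B.≈-trans (B.times-cong B.≈-refl (B.compl-cong (g.times-homo _ _))) (B.zero-below₂
        (B.solve 3 (𝐚 · (𝐛 · 𝐜) ′) (𝐚 · (𝐛 · 𝐜) ′ · (𝐚 · 𝐛 ′ + 𝐚 · 𝐜 ′))
          (b ∷ g.to (right h) ∷ g.to (right k) ∷ [])) (below-right h) (below-right k))
    }

  separated-zero : ∀ {a b} → a A.≈ A.zer → Separated a b
  separated-zero {a} {b} z = record
    { left = C.zer
    ; right = C.one
    ; disjoint = C.solve 0 (𝟎 · 𝟏) 𝟎 []
    ; below-left = A.⊓-zeroˡ _ z
    ; below-right = B.≈-trans (B.times-cong B.≈-refl (B.compl-cong g.one-homo)) (B.solve 1 (𝐚 · 𝟏 ′) 𝟎 (b ∷ []))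
    }

  -- A right separator above `one` is `one`, as `g` is injective, so the left one is zero. This
  -- makes the first factor embed injectively and keeps the unit condition good.
  separated-one : ∀ {a} → Separated a B.one → a A.≈ A.zer
  separated-one {a} h = A.zero-below₂
    (A.solve 2 𝐚 (𝐚 · (𝐚 · 𝐛 ′ + 𝐛)) (a ∷ f.to (left h) ∷ []))
    (below-left h)
    (A.≈-trans (f.cong left-zero) f.zer-homo)
    where
    right-one : C.∁ (right h) C.≈ C.zer
    right-one = g.injective (B.≈-trans (g.compl-homo _)
      (B.≈-trans (B.solve 1 (𝐚 ′) (𝟏 · 𝐚 ′) (g.to (right h) ∷ [])) (B.≈-trans (below-right h) (B.≈-sym g.zer-homo))))
    left-zero : left h C.≈ C.zer
    left-zero = C.zero-below₂ (C.solve 2 𝐚 (𝐚 · (𝐚 · 𝐛 + 𝐛 ′)) (left h ∷ right h ∷ [])) (disjoint h) right-one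

  -- Add `m` to the left separator and remove it from the right one. This identifies the two images
  -- of `m` in the amalgam.
  separated-transfer : ∀ {a b} m → Separated (A._⊓_ a (A.∁ (f.to m))) b → Separated a (B._⊓_ b (B.∁ (g.to m)))
  separated-transfer {a} {b} m h = record
    { left = C._⊔_ (left h) m
    ; right = C._⊓_ (right h) (C.∁ m)
    ; disjoint = C.zero-below (C.solve 3 ((𝐚 + 𝐜) · (𝐛 · 𝐜 ′)) ((𝐚 + 𝐜) · (𝐛 · 𝐜 ′) · (𝐚 · 𝐛))
        (left h ∷ right h ∷ m ∷ [])) (disjoint h)
    ; below-left = A.≈-trans (A.times-cong A.≈-refl (A.compl-cong (f.plus-homo _ _))) (A.≈-trans
        (A.solve 3 (𝐚 · (𝐛 + 𝐜) ′) (𝐚 · 𝐜 ′ · 𝐛 ′) (a ∷ f.to (left h) ∷ f.to m ∷ [])) (below-left h))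
    ; below-right = B.≈-trans
        (B.times-cong B.≈-refl (B.compl-cong (B.≈-trans (g.times-homo _ _) (B.times-cong B.≈-refl (g.compl-homo m)))))
        (B.zero-below (B.solve 3 (𝐚 · 𝐜 ′ · (𝐛 · 𝐜 ′) ′) (𝐚 · 𝐜 ′ · (𝐛 · 𝐜 ′) ′ · (𝐚 · 𝐛 ′))
          (b ∷ g.to (right h) ∷ g.to m ∷ [])) (below-right h))
    }

  separated-star : ∀ {a b} → Separated a b → Separated (A.star a) (B.star b)
  separated-star {a} {b} h = record
    { left = C.star (left h)
    ; right = C.star (right h)
    ; disjoint = C.≈-trans (C.≈-sym (C.star-⊓ _ _)) (C.≈-trans (C.star-cong (disjoint h)) C.star-zer)
    ; below-left = A.≈-trans (A.times-cong A.≈-refl (A.compl-cong (f.star-homo _)))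
        (A.≈-trans (A.solve 2 (𝐚 ⋆ · 𝐛 ⋆ ′) ((𝐚 · 𝐛 ′) ⋆) (a ∷ f.to (left h) ∷ []))
          (A.≈-trans (A.star-cong (below-left h)) A.star-zer))
    ; below-right = B.≈-trans (B.times-cong B.≈-refl (B.compl-cong (g.star-homo _)))
        (B.≈-trans (B.solve 2 (𝐚 ⋆ · 𝐛 ⋆ ′) ((𝐚 · 𝐛 ′) ⋆) (b ∷ g.to (right h) ∷ []))
          (B.≈-trans (B.star-cong (below-right h)) B.star-zer))
    }

-- The amalgam

module Amalgam {ℓ} (C A B : Structure ℓ)
  (C⊨ : Model ℓ BDA C) (A⊨ : Model ℓ BDA A) (B⊨ : Model ℓ BDA B) (f : Embedding C A) (g : Embedding C B) where
  private
    module C = Laws C C⊨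
    module A = Laws A A⊨
    module B = Laws B B⊨
    module L = Separation C A B C⊨ A⊨ B⊨ f g
    module R = Separation C B A C⊨ B⊨ A⊨ g f

  -- By this symmetry the facts about the second coordinate follow from those about the first, with
  -- `A` and `B` exchanged.
  flipL : ∀ {a b} → L.Separated a b → R.Separated b a
  flipL h = record
    { left = right ; right = left ; disjoint = C.≈-trans (C.solve 2 (𝐚 · 𝐛) (𝐛 · 𝐚) (right ∷ left ∷ [])) disjoint
    ; below-left = below-right ; below-right = below-left }
    where open L.Separated h

  flipR : ∀ {a b} → R.Separated b a → L.Separated a b
  flipR h = record
    { left = right ; right = left ; disjoint = C.≈-trans (C.solve 2 (𝐚 · 𝐛) (𝐛 · 𝐚) (right ∷ left ∷ [])) disjoint
    ; below-left = below-right ; below-right = below-left }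
    where open R.Separated h

  -- A condition stands for the meet of its two entries in the amalgam, and it is bad when this meet
  -- has to vanish.
  record Condition : Set ℓ where
    constructor ⟨_,_⟩
    field
      fst : A.Carrier
      snd : B.Carrier
  open Condition

  record _≼_ (p q : Condition) : Set ℓ where
    constructor _,_
    field
      fst≼ : A._⊓_ (fst p) (A.∁ (fst q)) A.≈ A.zer
      snd≼ : B._⊓_ (snd p) (B.∁ (snd q)) B.≈ B.zer

  Bad : Condition → Set ℓ
  Bad ⟨ a , b ⟩ = L.Separated a b

  bad-mono : ∀ {p q} → q ≼ p → Bad p → Bad q
  bad-mono (e , e′) = L.separated-mono e e′

  -- A condition lies below a generator when its meet with the complement of that generator is bad.
  forces : Condition → A.Carrier ⊎ B.Carrier → Set ℓ
  forces ⟨ a , b ⟩ (inj₁ c) = L.Separated (A._⊓_ a (A.∁ c)) b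
  forces ⟨ a , b ⟩ (inj₂ d) = L.Separated a (B._⊓_ b (B.∁ d))

  ≼-refl : ∀ {p} → p ≼ p
  ≼-refl = A.below A.≈-refl , B.below B.≈-refl

  forces-mono : ∀ c {p q} → q ≼ p → forces p c → forces q c
  forces-mono (inj₁ c) (e , e′) = L.separated-mono (A.below-⊓ e (A.below A.≈-refl)) e′
  forces-mono (inj₂ d) (e , e′) = L.separated-mono e (B.below-⊓ e′ (B.below B.≈-refl))

  -- The hypothesis is applied to the condition strengthened by the complement of the generator.
  -- Anything below it that forces the generator is bad, by splitting along the generator.
  forces-stable : ∀ p c → (∀ {q} → q ≼ p → (∀ {r} → r ≼ q → forces r c → Bad r) → Bad q) → forces p c
  forces-stable ⟨ a , b ⟩ (inj₁ c) h = h (A.⊓-lower a (A.∁ c) , B.below B.≈-refl)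
    λ (e , _) → L.separated-split c (L.separated-zero (A.below-∁ a c e))
  forces-stable ⟨ a , b ⟩ (inj₂ d) h = h (A.below A.≈-refl , B.⊓-lower b (B.∁ d))
    λ (_ , e) k → flipR (R.separated-split d (R.separated-zero (B.below-∁ b d e)) (flipL k))

  notion : ForcingNotion ℓ
  notion = record
    { Cond = Condition
    ; _≼_ = _≼_
    ; ≼-refl = ≼-refl
    ; ≼-trans = λ (e , e′) (k , k′) → A.below-trans e k , B.below-trans e′ k′
    ; Bad = Bad
    ; bad-mono = bad-mono
    ; conj = λ p → ⟨ A.star (fst p) , B.star (snd p) ⟩
    ; conj-mono = λ (e , e′) → A.below-star e , B.below-star e′
    ; conj-conj≼ = λ p → A.below (A.star-involutive _) , B.below (B.star-involutive _)
    ; ≼conj-conj = λ p → A.below (A.≈-sym (A.star-involutive _)) , B.below (B.≈-sym (B.star-involutive _))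
    ; bad-conj = L.separated-star
    ; unit = ⟨ A.one , B.one ⟩
    ; unit-good = λ h → A.nontrivial (L.separated-one h)
    ; Atom = A.Carrier ⊎ B.Carrier
    ; _⊩ₐ_ = forces
    ; atom-mono = λ {_} {_} {c} → forces-mono c
    ; atom-stable = λ {p} {c} → forces-stable p c
    }

  open ForcingAlgebra notion public

  private
    module GA = Generators.Restriction A A⊨ (λ p c → ⟨ A._⊓_ (fst p) c , snd p ⟩) inj₁ (λ h → h) (λ h → h)
      (λ p c → A.⊓-lower (fst p) c , B.below B.≈-refl)
      (λ (e , e′) k → L.separated-mono (A.below-⊓ e k) e′)
      L.separated-split
      (L.separated-mono (A.below (A.solve 3 (𝐚 · (𝐛 · 𝐜)) (𝐚 · 𝐛 · 𝐜) (_ ∷ _ ∷ _ ∷ []))) (B.below B.≈-refl))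
      (L.separated-mono (A.below (A.solve 3 (𝐚 · 𝐛 · 𝐜) (𝐚 · (𝐛 · 𝐜)) (_ ∷ _ ∷ _ ∷ []))) (B.below B.≈-refl))
      (λ h → L.separated-mono (A.below (A.≈-sym (A.star-⊓ _ _))) (B.below B.≈-refl) (L.separated-star h))
      (λ z → L.separated-zero (A.⊓-zeroʳ _ z))
      (λ h → A.≈-trans (A.solve 1 𝐚 (𝟏 · 𝐚) (_ ∷ [])) (L.separated-one h))
    module GB = Generators.Restriction B B⊨ (λ p d → ⟨ fst p , B._⊓_ (snd p) d ⟩) inj₂ (λ h → h) (λ h → h)
      (λ p d → A.below A.≈-refl , B.⊓-lower (snd p) d)
      (λ (e , e′) k → L.separated-mono e (B.below-⊓ e′ k))
      (λ d h k → flipR (R.separated-split d (flipL h) (flipL k)))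
      (L.separated-mono (A.below A.≈-refl) (B.below (B.solve 3 (𝐚 · (𝐛 · 𝐜)) (𝐚 · 𝐛 · 𝐜) (_ ∷ _ ∷ _ ∷ []))))
      (L.separated-mono (A.below A.≈-refl) (B.below (B.solve 3 (𝐚 · 𝐛 · 𝐜) (𝐚 · (𝐛 · 𝐜)) (_ ∷ _ ∷ _ ∷ []))))
      (λ h → L.separated-mono (A.below A.≈-refl) (B.below (B.≈-sym (B.star-⊓ _ _))) (L.separated-star h))
      (λ z → flipR (R.separated-zero (B.⊓-zeroʳ _ z)))
      (λ h → B.≈-trans (B.solve 1 𝐚 (𝟏 · 𝐚) (_ ∷ [])) (R.separated-one (flipL h)))

  g₁ : Embedding A P
  g₁ = GA.embedding

  g₂ : Embedding B P
  g₂ = GB.embedding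

  commutes : ∀ c → GA.ι (Embedding.to f c) ≋ GB.ι (Embedding.to g c)
  commutes c = (λ h → L.separated-transfer c h) ↔ (λ h → flipR (R.separated-transfer c (flipL h)))

identity : ∀ {ℓ} (M : Structure ℓ) → Embedding M M
identity M = record
  { to = λ a → a
  ; cong = λ e → e
  ; injective = λ e → e
  ; plus-homo = λ _ _ → refl′
  ; times-homo = λ _ _ → refl′
  ; compl-homo = λ _ → refl′
  ; neg-homo = λ _ → refl′
  ; star-homo = λ _ → refl′
  ; zer-homo = refl′
  ; one-homo = refl′
  }
  where open IsEquivalence (Structure.isEquivalence M) renaming (refl to refl′)

amalgamation : ∀ {ℓ} → Amalgamation ℓ BDA
amalgamation C A B C⊨ A⊨ B⊨ f g = P , P⊨BDA , g₁ , g₂ , commutes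
  where open Amalgam C A B C⊨ A⊨ B⊨ f g

theorem4p11 : ∀ {ℓ} → ExcludedMiddle ℓ →
    IsModelCompletion ℓ BDA ECBDA × Complete ℓ ECBDA × EliminatesQuantifiers ℓ ECBDA
theorem4p11 em =
    record
      { amalgamation = amalgamation
      ; isModelCompanion = record
        { modelComplete = modelComplete em
        ; embeds = embeds
        ; embeds-back = λ M M⊨ → M , (λ φ → M⊨ (bda φ)) , identity M
        }
      }
  , (consistent , decides em)
  , eliminatesQuantifiers em
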